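{- Let $k,l,n\in\mathbb{N}$. Then \[ \begin{split} n\, u_{k,l}(n) &= (2k+l)\sigma(n) - 2(5k +2l) \sigma(n/2) + 8k \sigma(n/4) \\ &\quad+ \sum_{j=1}^{n-1} u_{k,l}(j)\left( (2k+l)\sigma(n-j) -2(5k+2l)\sigma\!\left(\tfrac{n-j}{2}\right) + 8k\,\sigma\!\left(\tfrac{n-j}{4}\right) \right). \end{split} \]
   Context: For $k,l\in\mathbb{N}$ and $n\in\mathbb{N}_0$, $u_{k,l}(n)=\#\{(x_1,\dots,x_k,y_1,\dots,y_l)\in\mathbb{Z}^k\times\mathbb{N}_0^l : n=\sum_{i=1}^k x_i^2+\sum_{i=1}^l \frac{y_i(y_i+1)}{2}\}$, where $\mathbb{N}_0=\{0,1,2,\dots\}$. The function $\sigma$ is defined on $\mathbb{Q}$ by $\sigma(0)=1$, $\sigma(q)=0$ if $q\in\mathbb{Q}\setminus\mathbb{N}_0$, and $\sigma(q)=\sum_{d\mid q} d$ for $q\in\mathbb{N}=\{1,2,\dots\}$. -}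

module Defs where

open import Data.Nat as ℕ using (ℕ; zero; suc)
open import Data.Nat.Divisibility using (_∣?_)
open import Data.Integer as ℤ using (ℤ; +_)
open import Data.Rational using (ℚ; mkℚ)
open import Data.List using (List; []; _∷_; map; filter; length; concatMap; upTo; applyUpTo; foldr)
open import Data.Vec using (Vec; []; _∷_)
import Data.Product as P

sumℤ : List ℤ → ℤ
sumℤ = foldr ℤ._+_ (+ 0)

sumℕ : List ℕ → ℕ
sumℕ = foldr ℕ._+_ 0

σℕ : ℕ → ℕ
σℕ zero    = 1
σℕ (suc q) = sumℕ (filter (λ d → d ∣? suc q) (applyUpTo suc (suc q)))

-- σ on ℚ: σ(q) = σℕ(q) if q ∈ ℕ₀ (numerator ≥ 0, denominator 1), else 0.
σ : ℚ → ℕ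
σ (mkℚ (+ m) zero _) = σℕ m
σ _                  = 0

vecsFrom : {A : Set} → (k : ℕ) → List A → List (Vec A k)
vecsFrom zero    xs = [] ∷ []
vecsFrom (suc k) xs = concatMap (λ x → map (x ∷_) (vecsFrom k xs)) xs

sumSq : {k : ℕ} → Vec ℤ k → ℕ
sumSq []       = 0
sumSq (x ∷ xs) = ℤ.∣ x ℤ.* x ∣ ℕ.+ sumSq xs

sumTri : {l : ℕ} → Vec ℕ l → ℕ
sumTri []       = 0
sumTri (y ∷ ys) = (y ℕ.* suc y) ℕ./ 2 ℕ.+ sumTri ys

rangeℤ : ℕ → List ℤ
rangeℤ n = map (λ i → + i ℤ.- + n) (upTo (suc (n ℕ.+ n)))

rangeℕ : ℕ → List ℕ
rangeℕ n = upTo (suc n)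

-- u_{k,l}(n) = #{(x,y) ∈ ℤ^k × ℕ₀^l : n = Σ x_i² + Σ y_i(y_i+1)/2}.
-- Any solution has |x_i| ≤ n and y_i ≤ n, so it suffices to count
-- within the finite box [-n,n]^k × [0,n]^l (each tuple listed once).
u : ℕ → ℕ → ℕ → ℕ
u k l n = length (filter (λ p → (sumSq (P.proj₁ p) ℕ.+ sumTri (P.proj₂ p)) ℕ.≟ n) box)
  where
  box : List (Vec ℤ k P.× Vec ℕ l)
  box = concatMap (λ xs → map (xs P.,_) (vecsFrom l (rangeℕ n))) (vecsFrom k (rangeℤ n))

{-# OPTIONS --safe #-}

-- The generating function of u k l is θᵏψˡ with θ = Σ_{x ∈ ℤ} q^(x²) and ψ = Σ_{y ≥ 0} q^(y(y+1)/2), so it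
-- suffices to compute the logarithmic derivatives of θ and ψ and to add them up.  Both come from one
-- Liouville-type identity for the form Q(x) = x (x + ε), ε ∈ {0, 1}.  In
--   Σ over Q(x) + d e = C with d, e ≥ 1 of  ((-1)^(d+e+ε) - (-1)^e) d
-- the substitutions x = n ∓ e, d = f - e ± (2n + ε) turn the condition into Q(n) + e f = C, which is symmetric
-- in e and f, and the sign into (-1)^f - (-1)^e, which is antisymmetric.  Averaging the two substitutions, the
-- terms with f < 0 cancel, those with f > 0 give a divisor sum of C - Q(n), and those with f = 0 occur only
-- for Q(n) = C and add up to C.
module Submission where

open import Defs
open import Data.Nat using (ℕ; _≥_; _∸_)
open import Data.Integer using (ℤ; +_; _+_; _-_; _*_)
open import Data.Rational using (ℚ; _/_)
open import Data.List using (map; applyUpTo)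
open import Data.Nat using (suc)
open import Relation.Binary.PropositionalEquality using (_≡_)

import Data.Nat as ℕ
import Data.Nat.Divisibility as ℕ
import Data.Nat.Properties as ℕ
import Data.Nat.Coprimality as Coprimality
import Data.Nat.Tactic.RingSolver as ℕ-solver
import Data.Integer as ℤ using (_≤_; +≤+)
import Data.Integer.GCD as ℤ using (gcd)
import Data.Integer.Properties as ℤ
import Data.Rational.Properties as ℚ
open import Data.Bool using (if_then_else_)
open import Data.Empty using (⊥-elim)
open import Data.Integer using (-[1+_]; -_; ∣_∣)
open import Data.Integer.Tactic.RingSolver using (solve-∀)
open import Data.List using (List; []; _∷_; _++_; _∷ʳ_; concatMap; filter; length; upTo)
open import Data.List.Properties using (applyUpTo-∷ʳ; map-upTo; upTo-∷ʳ)
open import Data.Nat using (zero; _≤_; _<_; z≤n; s≤s; NonZero)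
open import Data.Nat.Divisibility using (_∣_; _∣?_; divides; divides-refl)
open import Data.Nat.DivMod using (m/n*n≡m)
open import Data.Product using (∃; _×_; _,_; proj₁; proj₂)
open import Data.Rational using (mkℚ; ↥_; ↧_)
open import Data.Rational.Unnormalised using (mkℚᵘ; *≡*)
open import Data.Sum using (_⊎_; inj₁; inj₂)
open import Data.Vec using (Vec; []; _∷_)
open import Function using (_∘_)
open import Relation.Binary.PropositionalEquality using (_≢_; refl; sym; trans; cong; cong₂; subst; module ≡-Reasoning)
open import Relation.Nullary using (¬_; Dec; yes; no; does)
open import Relation.Unary using (Decidable)
open ≡-Reasoning

private variable
  A B : Set

-- Two substitutions are needed because of the constraint d ≥ 1. Written as a factor `pos d`, it
-- lets d and f run through ℤ, and each substitution becomes a translation of x for fixed e,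
-- followed by a translation of d. Put μ = 2n + ε. For f = -i the factor `pos (- i - e ± μ)` is
-- symmetric in e and i, so each substitution cancels alone. For f = i > 0 the exchange of e and i
-- turns i - e + μ into -(i - e - μ), so it interchanges the two substitutions up to sign. Since pos
-- z = (|z| + z) / 2, the absolute values of such a pair add up to a symmetric function and cancel
-- against the antisymmetric sign; only the linear weight i - e survives. Both sides are then
-- divisor sums of C - Q(x), and the resulting identity, with C times the number of x with Q(x) = C
-- on one side, is the coefficient of q^C in q F′ = F · G for F = Σ q^Q(x). No infinite sum occurs:
-- all sums run over finite windows, wide enough for the translations to lose only zero terms.

halve : ∀ {x y} → x + x ≡ y + y → x ≡ y
halve {x} {y} eq = ℤ.*-cancelˡ-≡ (+ 2) x y (trans (double x) (trans eq (sym (double y))))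
  where
  double : ∀ x → + 2 * x ≡ x + x
  double = solve-∀

self-negative : ∀ {x} → x ≡ - x → x ≡ + 0
self-negative {x} eq = halve (trans (cong (_+_ x) eq) (ℤ.+-inverseʳ x))

-- Finite sums

∑ : List A → (A → ℤ) → ℤ
∑ []       f = + 0
∑ (x ∷ xs) f = f x + ∑ xs f

∑-cong : ∀ (xs : List A) {f g} → (∀ x → f x ≡ g x) → ∑ xs f ≡ ∑ xs g
∑-cong []       eq = refl
∑-cong (x ∷ xs) eq = cong₂ _+_ (eq x) (∑-cong xs eq)

∑-zero : ∀ (xs : List A) {f} → (∀ x → f x ≡ + 0) → ∑ xs f ≡ + 0
∑-zero []       eq = refl
∑-zero (x ∷ xs) eq = cong₂ _+_ (eq x) (∑-zero xs eq)

private
  interchange : ∀ a b c d → a + b + (c + d) ≡ a + c + (b + d)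
  interchange = solve-∀

∑-+ : ∀ (xs : List A) f g → ∑ xs (λ x → f x + g x) ≡ ∑ xs f + ∑ xs g
∑-+ []       f g = refl
∑-+ (x ∷ xs) f g = trans (cong (_+_ (f x + g x)) (∑-+ xs f g)) (interchange (f x) (g x) _ _)

∑-* : ∀ c (xs : List A) f → ∑ xs (λ x → c * f x) ≡ c * ∑ xs f
∑-* c []       f = sym (ℤ.*-zeroʳ c)
∑-* c (x ∷ xs) f = trans (cong (_+_ (c * f x)) (∑-* c xs f)) (sym (ℤ.*-distribˡ-+ c (f x) _))

∑-neg : ∀ (xs : List A) f → ∑ xs (λ x → - f x) ≡ - ∑ xs f
∑-neg []       f = refl
∑-neg (x ∷ xs) f = trans (cong (_+_ (- f x)) (∑-neg xs f)) (sym (ℤ.neg-distrib-+ (f x) _))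

∑-swap : ∀ (xs : List A) (ys : List B) (f : A → B → ℤ) →
         ∑ xs (λ x → ∑ ys (f x)) ≡ ∑ ys (λ y → ∑ xs (λ x → f x y))
∑-swap []       ys f = sym (∑-zero ys (λ _ → refl))
∑-swap (x ∷ xs) ys f = trans (cong (_+_ (∑ ys (f x))) (∑-swap xs ys f)) (sym (∑-+ ys (f x) _))

∑-map : ∀ (g : A → B) xs f → ∑ (map g xs) f ≡ ∑ xs (f ∘ g)
∑-map g []       f = refl
∑-map g (x ∷ xs) f = cong (_+_ (f (g x))) (∑-map g xs f)

∑-++ : ∀ (xs ys : List A) f → ∑ (xs ++ ys) f ≡ ∑ xs f + ∑ ys f
∑-++ []       ys f = sym (ℤ.+-identityˡ _)
∑-++ (x ∷ xs) ys f = trans (cong (_+_ (f x)) (∑-++ xs ys f)) (sym (ℤ.+-assoc (f x) _ _))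

∑-concatMap : ∀ (g : A → List B) xs f → ∑ (concatMap g xs) f ≡ ∑ xs (λ x → ∑ (g x) f)
∑-concatMap g []       f = refl
∑-concatMap g (x ∷ xs) f =
  trans (∑-++ (g x) _ f) (cong (_+_ (∑ (g x) f)) (∑-concatMap g xs f))

interval : ℕ → List ℕ
interval zero    = []
interval (suc n) = suc n ∷ interval n

-- The two ends are listed as a pair, so that an induction on the radius adds both at once and
-- negation only swaps inside pairs.
symmetric : ℕ → List ℤ
symmetric zero    = + 0 ∷ []
symmetric (suc n) = + suc n ∷ -[1+ n ] ∷ symmetric n

∑-interval-cong : ∀ M {f g} → (∀ i → 1 ≤ i → i ≤ M → f i ≡ g i) →
                  ∑ (interval M) f ≡ ∑ (interval M) g
∑-interval-cong zero    eq = refl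
∑-interval-cong (suc M) eq = cong₂ _+_ (eq (suc M) (s≤s z≤n) ℕ.≤-refl)
  (∑-interval-cong M (λ i 1≤i i≤M → eq i 1≤i (ℕ.m≤n⇒m≤1+n i≤M)))

∑-symmetric-cong : ∀ M {f g} → (∀ x → ∣ x ∣ ≤ M → f x ≡ g x) →
                   ∑ (symmetric M) f ≡ ∑ (symmetric M) g
∑-symmetric-cong zero    eq = cong (_+ + 0) (eq (+ 0) z≤n)
∑-symmetric-cong (suc M) eq =
  cong₂ _+_ (eq _ ℕ.≤-refl) (cong₂ _+_ (eq _ ℕ.≤-refl)
    (∑-symmetric-cong M (λ x x≤M → eq x (ℕ.m≤n⇒m≤1+n x≤M))))

∑-interval-extend : ∀ {N M} f → (∀ i → N < i → f i ≡ + 0) → N ≤ M →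
                    ∑ (interval M) f ≡ ∑ (interval N) f
∑-interval-extend {N} {zero}  f f≡0 z≤n = refl
∑-interval-extend {N} {suc M} f f≡0 N≤1+M with ℕ.m≤n⇒m<n∨m≡n N≤1+M
... | inj₂ refl      = refl
... | inj₁ (s≤s N≤M) = trans (cong₂ _+_ (f≡0 (suc M) (s≤s N≤M)) (∑-interval-extend f f≡0 N≤M))
                             (ℤ.+-identityˡ _)

∑-symmetric-extend : ∀ {N M} f → (∀ x → N < ∣ x ∣ → f x ≡ + 0) → N ≤ M →
                     ∑ (symmetric M) f ≡ ∑ (symmetric N) f
∑-symmetric-extend {N} {zero}  f f≡0 z≤n = refl
∑-symmetric-extend {N} {suc M} f f≡0 N≤1+M with ℕ.m≤n⇒m<n∨m≡n N≤1+M
... | inj₂ refl      = refl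
... | inj₁ (s≤s N≤M) =
  trans (cong₂ _+_ (f≡0 (+ suc M) (s≤s N≤M))
          (cong₂ _+_ (f≡0 -[1+ M ] (s≤s N≤M)) (∑-symmetric-extend f f≡0 N≤M)))
        (trans (ℤ.+-identityˡ _) (ℤ.+-identityˡ _))

∑-interval-snoc : ∀ M f → ∑ (interval (suc M)) f ≡ f 1 + ∑ (interval M) (f ∘ suc)
∑-interval-snoc zero    f = refl
∑-interval-snoc (suc M) f =
  trans (cong (_+_ (f (suc (suc M)))) (∑-interval-snoc M f)) (left-comm (f (suc (suc M))) (f 1) _)
  where
  left-comm : ∀ a b c → a + (b + c) ≡ b + (a + c)
  left-comm = solve-∀

∑-interval-single : ∀ M f b → 1 ≤ b → b ≤ M → (∀ i → i ≢ b → f i ≡ + 0) →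
                    ∑ (interval M) f ≡ f b
∑-interval-single M f (suc b) 1≤b b≤M f≡0 = begin
  ∑ (interval M) f            ≡⟨ ∑-interval-extend f (λ i b<i → f≡0 i (ℕ.>⇒≢ b<i)) b≤M ⟩
  f (suc b) + ∑ (interval b) f ≡⟨ cong (_+_ (f (suc b))) (trans (∑-interval-cong b below)
                                    (∑-zero (interval b) (λ _ → refl))) ⟩
  f (suc b) + + 0             ≡⟨ ℤ.+-identityʳ _ ⟩
  f (suc b)                   ∎
  where
  below : ∀ i → 1 ≤ i → i ≤ b → f i ≡ + 0
  below i _ i≤b = f≡0 i (ℕ.<⇒≢ (s≤s i≤b))

∑-symmetric-split : ∀ M f → ∑ (symmetric M) f ≡
  f (+ 0) + (∑ (interval M) (λ i → f (+ i)) + ∑ (interval M) (λ i → f (- + i)))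
∑-symmetric-split zero    f = refl
∑-symmetric-split (suc M) f =
  trans (cong (λ t → f (+ suc M) + (f -[1+ M ] + t)) (∑-symmetric-split M f))
        (regroup (f (+ suc M)) (f -[1+ M ]) (f (+ 0)) _ _)
  where
  regroup : ∀ a b c d e → a + (b + (c + (d + e))) ≡ c + ((a + d) + (b + e))
  regroup = solve-∀

∑-symmetric-neg : ∀ M f → ∑ (symmetric M) (f ∘ -_) ≡ ∑ (symmetric M) f
∑-symmetric-neg zero    f = refl
∑-symmetric-neg (suc M) f =
  trans (cong (λ t → f -[1+ M ] + (f (+ suc M) + t)) (∑-symmetric-neg M f))
        (left-comm (f -[1+ M ]) (f (+ suc M)) _)
  where
  left-comm : ∀ a b c → a + (b + c) ≡ b + (a + c)
  left-comm = solve-∀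

∑-symmetric-suc : ∀ M f → ∑ (symmetric M) (λ x → f (x + + 1)) + f (- + M) ≡
                          ∑ (symmetric M) f + f (+ suc M)
∑-symmetric-suc zero    f = flip (f (+ 1)) (f (+ 0))
  where
  flip : ∀ a b → a + + 0 + b ≡ b + + 0 + a
  flip = solve-∀
∑-symmetric-suc (suc M) f = begin
  f (+ suc (M ℕ.+ 1)) + (f (-[1+ M ] + + 1) + S) + f -[1+ M ]
    ≡⟨ cong₂ (λ a b → f a + (f b + S) + f -[1+ M ]) (cong (λ k → + suc k) (ℕ.+-comm M 1)) (-[1+]+1 M) ⟩
  f (+ suc (suc M)) + (f (- + M) + S) + f -[1+ M ]
    ≡⟨ regroup (f (+ suc (suc M))) (f (- + M)) S (f -[1+ M ]) ⟩
  (S + f (- + M)) + (f (+ suc (suc M)) + f -[1+ M ])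
    ≡⟨ cong (_+ (f (+ suc (suc M)) + f -[1+ M ])) (∑-symmetric-suc M f) ⟩
  (∑ (symmetric M) f + f (+ suc M)) + (f (+ suc (suc M)) + f -[1+ M ])
    ≡⟨ regroup′ (∑ (symmetric M) f) (f (+ suc M)) (f (+ suc (suc M))) (f -[1+ M ]) ⟩
  f (+ suc M) + (f -[1+ M ] + ∑ (symmetric M) f) + f (+ suc (suc M)) ∎
  where
  S = ∑ (symmetric M) (λ x → f (x + + 1))
  -[1+]+1 : ∀ M → -[1+ M ] + + 1 ≡ - + M
  -[1+]+1 zero    = refl
  -[1+]+1 (suc M) = refl
  regroup : ∀ a b c d → a + (b + c) + d ≡ (c + b) + (a + d)
  regroup = solve-∀
  regroup′ : ∀ a b c d → (a + b) + (c + d) ≡ b + (d + a) + c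
  regroup′ = solve-∀

private
  outside : ∀ R₀ n x → R₀ ℕ.+ n < ∣ x ∣ → R₀ < ∣ x + + n ∣
  outside R₀ n x lt = ℕ.+-cancelʳ-< n R₀ _ (ℕ.<-≤-trans lt
    (subst (_≤ ∣ x + + n ∣ ℕ.+ n) (cong ∣_∣ (cancel x (+ n)))
      (subst (∣ x + + n - + n ∣ ≤_) (cong (∣ x + + n ∣ ℕ.+_) (ℤ.∣-i∣≡∣i∣ (+ n)))
        (ℤ.∣i+j∣≤∣i∣+∣j∣ (x + + n) (- + n)))))
    where
    cancel : ∀ x n → x + n - n ≡ x
    cancel = solve-∀

  shift⁺ : ∀ {R₀ R} f n → (∀ x → R₀ < ∣ x ∣ → f x ≡ + 0) → R₀ ℕ.+ n ≤ R →
           ∑ (symmetric R) (λ x → f (x + + n)) ≡ ∑ (symmetric R) f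
  shift⁺ {R₀} {R} f zero    f≡0 le = ∑-cong (symmetric R) (λ x → cong f (ℤ.+-identityʳ x))
  shift⁺ {R₀} {R} f (suc n) f≡0 le = begin
    ∑ (symmetric R) (λ x → f (x + + suc n))   ≡⟨ ∑-cong (symmetric R) (λ x → cong f (assoc x)) ⟩
    ∑ (symmetric R) (λ x → g (x + + 1))       ≡⟨ ℤ.+-identityʳ _ ⟨
    ∑ (symmetric R) (λ x → g (x + + 1)) + + 0 ≡⟨ cong (_+_ (∑ (symmetric R) (λ x → g (x + + 1)))) (g≡0 (- + R) (subst (R₀ ℕ.+ n <_) (sym (ℤ.∣-i∣≡∣i∣ (+ R))) lt)) ⟨
    ∑ (symmetric R) (λ x → g (x + + 1)) + g (- + R) ≡⟨ ∑-symmetric-suc R g ⟩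
    ∑ (symmetric R) g + g (+ suc R)           ≡⟨ cong (_+_ (∑ (symmetric R) g)) (g≡0 (+ suc R) (ℕ.m≤n⇒m≤1+n lt)) ⟩
    ∑ (symmetric R) g + + 0                   ≡⟨ ℤ.+-identityʳ _ ⟩
    ∑ (symmetric R) g                         ≡⟨ shift⁺ f n f≡0 (ℕ.<⇒≤ lt) ⟩
    ∑ (symmetric R) f                         ∎
    where
    g : ℤ → ℤ
    g x = f (x + + n)
    lt : R₀ ℕ.+ n < R
    lt = subst (_≤ R) (ℕ.+-suc R₀ n) le
    g≡0 : ∀ x → R₀ ℕ.+ n < ∣ x ∣ → g x ≡ + 0
    g≡0 x = f≡0 _ ∘ outside R₀ n x
    assoc : ∀ x → x + + suc n ≡ x + + 1 + + n
    assoc x = sym (ℤ.+-assoc x (+ 1) (+ n))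

-- In a finite window a translation is harmless only if the values that leave or enter at the ends
-- are 0. The support lies in [-R₀, R₀], so a margin of |c| suffices.
∑-symmetric-shift : ∀ {R₀ R} f c → (∀ x → R₀ < ∣ x ∣ → f x ≡ + 0) → R₀ ℕ.+ ∣ c ∣ ≤ R →
                    ∑ (symmetric R) (λ x → f (x + c)) ≡ ∑ (symmetric R) f
∑-symmetric-shift f (+ n) f≡0 le = shift⁺ f n f≡0 le
∑-symmetric-shift {R₀} {R} f -[1+ n ] f≡0 le = begin
  ∑ (symmetric R) (λ x → f (x + -[1+ n ]))     ≡⟨ ∑-symmetric-neg R (λ x → f (x + -[1+ n ])) ⟨
  ∑ (symmetric R) (λ x → f (- x + -[1+ n ]))   ≡⟨ ∑-cong (symmetric R) (λ x → cong f (ℤ.neg-distrib-+ x (+ suc n))) ⟨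
  ∑ (symmetric R) (λ x → f (- (x + + suc n)))  ≡⟨ shift⁺ (f ∘ -_) (suc n) (λ x lt → f≡0 (- x) (subst (R₀ <_) (sym (ℤ.∣-i∣≡∣i∣ x)) lt)) le ⟩
  ∑ (symmetric R) (f ∘ -_)                     ≡⟨ ∑-symmetric-neg R f ⟩
  ∑ (symmetric R) f                            ∎

-- Exchanging the two variables shows that the sum is its own negative. This requires one common
-- range for both, which later dictates the ranges of e and f.
∑-antisymmetric : ∀ M (f : ℕ → ℕ → ℤ) → (∀ i j → f i j ≡ - f j i) →
  ∑ (interval M) (λ i → ∑ (interval M) (f i)) ≡ + 0
∑-antisymmetric M f anti = self-negative (begin
  ∑ I (λ i → ∑ I (f i))             ≡⟨ ∑-swap I I f ⟩
  ∑ I (λ j → ∑ I (λ i → f i j))     ≡⟨ ∑-cong I (λ j → trans (∑-cong I (λ i → anti i j)) (∑-neg I (f j))) ⟩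
  ∑ I (λ j → - ∑ I (f j))           ≡⟨ ∑-neg I _ ⟩
  - ∑ I (λ i → ∑ I (f i))           ∎)
  where
  I = interval M

-- Indicators, signs and positive parts

δ : ℤ → ℤ
δ (+ zero)  = + 1
δ (+ suc _) = + 0
δ -[1+ _ ]  = + 0

δ-≢0 : ∀ {z} → z ≢ + 0 → δ z ≡ + 0
δ-≢0 {+ zero}   z≢0 = ⊥-elim (z≢0 refl)
δ-≢0 {+ suc _}  z≢0 = refl
δ-≢0 { -[1+ _ ]} z≢0 = refl

δ-*-cong : ∀ z {a b} → (z ≡ + 0 → a ≡ b) → δ z * a ≡ δ z * b
δ-*-cong (+ zero)  eq = cong (+ 1 *_) (eq refl)
δ-*-cong (+ suc _) eq = refl
δ-*-cong -[1+ _ ]  eq = refl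

δ-*-zero : ∀ z {a} → (z ≡ + 0 → a ≡ + 0) → δ z * a ≡ + 0
δ-*-zero z eq = trans (δ-*-cong z eq) (ℤ.*-zeroʳ (δ z))

parity : ℕ → ℤ
parity zero    = + 1
parity (suc n) = - parity n

sgn : ℤ → ℤ
sgn z = parity ∣ z ∣

sgn-neg : ∀ z → sgn (- z) ≡ sgn z
sgn-neg z = cong parity (ℤ.∣-i∣≡∣i∣ z)

sgn-suc : ∀ z → sgn (+ 1 + z) ≡ - sgn z
sgn-suc (+ n)          = refl
sgn-suc -[1+ zero ]    = refl
sgn-suc -[1+ suc n ]   = sym (ℤ.neg-involutive _)

sgn-+ : ∀ a b → sgn (a + b) ≡ sgn a * sgn b
sgn-+ (+ n) b = go n
  where
  go : ∀ n → sgn (+ n + b) ≡ parity n * sgn b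
  go zero    = trans (cong sgn (ℤ.+-identityˡ b)) (sym (ℤ.*-identityˡ _))
  go (suc n) = trans (cong sgn (ℤ.+-assoc (+ 1) (+ n) b)) (trans (sgn-suc (+ n + b))
    (trans (cong -_ (go n)) (ℤ.neg-distribˡ-* (parity n) (sgn b))))
sgn-+ -[1+ n ] b = trans (sym (sgn-neg (-[1+ n ] + b))) (trans (cong sgn (ℤ.neg-distrib-+ -[1+ n ] b))
  (trans (sgn-+ (+ suc n) (- b)) (cong (parity (suc n) *_) (sgn-neg b))))

sgn² : ∀ z → sgn z * sgn z ≡ + 1
sgn² z = go ∣ z ∣
  where
  neg-square : ∀ x → - x * - x ≡ x * x
  neg-square = solve-∀
  go : ∀ n → parity n * parity n ≡ + 1
  go zero    = refl
  go (suc n) = trans (neg-square (parity n)) (go n)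

sgn-even-shift : ∀ z w → sgn (z + (w + w)) ≡ sgn z
sgn-even-shift z w = trans (sgn-+ z (w + w))
  (trans (cong (sgn z *_) (trans (sgn-+ w w) (sgn² w))) (ℤ.*-identityʳ _))

pos : ℤ → ℤ
pos (+ n)    = + n
pos -[1+ _ ] = + 0

pos-neg : ∀ z → pos (- z) ≡ pos z - z
pos-neg (+ zero)  = refl
pos-neg (+ suc n) = sym (ℤ.+-inverseʳ (+ suc n))
pos-neg -[1+ n ]  = refl

pos-nonpos : ∀ n → pos (- + n) ≡ + 0
pos-nonpos zero    = refl
pos-nonpos (suc n) = refl

-- Divisor sums

parity-double : ∀ n → parity (n ℕ.+ n) ≡ + 1
parity-double zero    = refl
parity-double (suc n) = trans (cong (-_ ∘ parity) (ℕ.+-suc n n))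
  (trans (ℤ.neg-involutive _) (parity-double n))

-- 1 + (-1)^i is 2 for even i and 0 for odd i. The range has even length, so each induction step
-- adds one even and one odd index.
∑-even : ∀ M g → ∑ (interval (M ℕ.+ M)) (λ i → g i * parity i) + ∑ (interval (M ℕ.+ M)) g ≡
                 + 2 * ∑ (interval M) (λ i → g (i ℕ.+ i))
∑-even zero    g = refl
∑-even (suc M) g rewrite ℕ.+-suc M M | parity-double M = begin
  x * + 1 + (y * (- + 1) + P) + (x + (y + S)) ≡⟨ collect x y P S ⟩
  + 2 * x + (P + S)                         ≡⟨ cong (_+_ (+ 2 * x)) (∑-even M g) ⟩
  + 2 * x + + 2 * E                         ≡⟨ ℤ.*-distribˡ-+ (+ 2) x E ⟨
  + 2 * (x + E)                             ∎
  where
  x = g (suc (suc (M ℕ.+ M)))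
  y = g (suc (M ℕ.+ M))
  P = ∑ (interval (M ℕ.+ M)) (λ i → g i * parity i)
  S = ∑ (interval (M ℕ.+ M)) g
  E = ∑ (interval M) (λ i → g (i ℕ.+ i))
  collect : ∀ x y P S → x * + 1 + (y * (- + 1) + P) + (x + (y + S)) ≡ + 2 * x + (P + S)
  collect = solve-∀

-- The vanishing beyond M allows the range to grow to 2M, where `∑-even` applies.
∑-parity : ∀ M g → (∀ i → M < i → g i ≡ + 0) →
  ∑ (interval M) (λ i → g i * parity i) ≡ + 2 * ∑ (interval M) (λ i → g (i ℕ.+ i)) - ∑ (interval M) g
∑-parity M g g≡0 = begin
  ∑ (interval M) (λ i → g i * parity i)           ≡⟨ cancel _ _ ⟩
  ∑ (interval M) (λ i → g i * parity i) + ∑ (interval M) g - ∑ (interval M) g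
    ≡⟨ cong (_- ∑ (interval M) g) (cong₂ _+_
         (∑-interval-extend _ (λ i M<i → cong (_* parity i) (g≡0 i M<i)) (ℕ.m≤m+n M M))
         (∑-interval-extend g g≡0 (ℕ.m≤m+n M M))) ⟨
  ∑ (interval (M ℕ.+ M)) (λ i → g i * parity i) + ∑ (interval (M ℕ.+ M)) g - ∑ (interval M) g
    ≡⟨ cong (_- ∑ (interval M) g) (∑-even M g) ⟩
  + 2 * ∑ (interval M) (λ i → g (i ℕ.+ i)) - ∑ (interval M) g ∎
  where
  cancel : ∀ a b → a ≡ a + b - b
  cancel = solve-∀

δ-large : ∀ {K M} z → K ℤ.≤ + M → M < z → δ (+ z - K) ≡ + 0
δ-large {K} z K≤M M<z = δ-≢0 (λ eq → ℕ.<⇒≱ M<z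
  (ℤ.drop‿+≤+ (subst (ℤ._≤ _) (sym (ℤ.i-j≡0⇒i≡j (+ z) K eq)) K≤M)))

-- τ M c w K is the sum of w a over the factorisations K = c a b with a, b ≤ M.
τ : ℕ → ℕ → (ℕ → ℤ) → ℤ → ℤ
τ M c w K = ∑ (interval M) λ a → ∑ (interval M) λ b → δ (+ (c ℕ.* (a ℕ.* b)) - K) * w a

factor-large : ∀ {M c a b} → 1 ≤ c → 1 ≤ a → M < b → M < c ℕ.* (a ℕ.* b)
factor-large {M} {suc c} {suc a} {b} _ _ M<b =
  ℕ.<-≤-trans M<b (ℕ.≤-trans (ℕ.m≤m+n b _) (ℕ.m≤m+n (b ℕ.+ a ℕ.* b) _))

module _ {M K} (K≤M : K ℤ.≤ + M) where

  -- An even b = 2b′ turns c a b into (2c) a b′, so resolving the sign (-1)^b trades c for 2c.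
  τ-parityʳ : ∀ c w → 1 ≤ c →
    ∑ (interval M) (λ a → ∑ (interval M) (λ b → δ (+ (c ℕ.* (a ℕ.* b)) - K) * (w a * parity b)))
    ≡ + 2 * τ M (2 ℕ.* c) w K - τ M c w K
  τ-parityʳ c w 1≤c = begin
    ∑ I (λ a → ∑ I (λ b → h c a b * (w a * parity b)))
      ≡⟨ ∑-interval-cong M inner ⟩
    ∑ I (λ a → + 2 * ∑ I (λ b → h (2 ℕ.* c) a b * w a) + - ∑ I (λ b → h c a b * w a))
      ≡⟨ ∑-+ I _ _ ⟩
    ∑ I (λ a → + 2 * ∑ I (λ b → h (2 ℕ.* c) a b * w a)) + ∑ I (λ a → - ∑ I (λ b → h c a b * w a))
      ≡⟨ cong₂ _+_ (∑-* (+ 2) I _) (∑-neg I _) ⟩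
    + 2 * τ M (2 ℕ.* c) w K - τ M c w K ∎
    where
    I = interval M
    h : ℕ → ℕ → ℕ → ℤ
    h c a b = δ (+ (c ℕ.* (a ℕ.* b)) - K)
    double : ∀ c a b → c ℕ.* (a ℕ.* (b ℕ.+ b)) ≡ 2 ℕ.* c ℕ.* (a ℕ.* b)
    double = ℕ-solver.solve-∀
    inner : ∀ a → 1 ≤ a → a ≤ M → ∑ I (λ b → h c a b * (w a * parity b)) ≡
            + 2 * ∑ I (λ b → h (2 ℕ.* c) a b * w a) + - ∑ I (λ b → h c a b * w a)
    inner a 1≤a _ = begin
      ∑ I (λ b → h c a b * (w a * parity b))
        ≡⟨ ∑-cong I (λ b → ℤ.*-assoc (h c a b) (w a) (parity b)) ⟨
      ∑ I (λ b → h c a b * w a * parity b)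
        ≡⟨ ∑-parity M _ (λ b M<b → cong (_* w a) (δ-large _ K≤M (factor-large 1≤c 1≤a M<b))) ⟩
      + 2 * ∑ I (λ b → h c a (b ℕ.+ b) * w a) - ∑ I (λ b → h c a b * w a)
        ≡⟨ cong (λ t → + 2 * t - ∑ I (λ b → h c a b * w a))
             (∑-cong I (λ b → cong (λ z → δ (+ z - K) * w a) (double c a b))) ⟩
      + 2 * ∑ I (λ b → h (2 ℕ.* c) a b * w a) - ∑ I (λ b → h c a b * w a) ∎

  -- The substitution a = 2a′ doubles the weight as well, hence the coefficient 4 = 2 · 2.
  τ-parityˡ : ∀ c → 1 ≤ c →
    τ M c (λ a → + a * parity a) K ≡ + 4 * τ M (2 ℕ.* c) (+_) K - τ M c (+_) K
  τ-parityˡ c 1≤c = begin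
    τ M c (λ a → + a * parity a) K
      ≡⟨ ∑-swap I I _ ⟩
    ∑ I (λ b → ∑ I (λ a → h c a b * (+ a * parity a)))
      ≡⟨ ∑-interval-cong M inner ⟩
    ∑ I (λ b → + 4 * ∑ I (λ a → h (2 ℕ.* c) a b * + a) + - ∑ I (λ a → h c a b * + a))
      ≡⟨ ∑-+ I _ _ ⟩
    ∑ I (λ b → + 4 * ∑ I (λ a → h (2 ℕ.* c) a b * + a)) + ∑ I (λ b → - ∑ I (λ a → h c a b * + a))
      ≡⟨ cong₂ _+_ (∑-* (+ 4) I _) (∑-neg I _) ⟩
    + 4 * ∑ I (λ b → ∑ I (λ a → h (2 ℕ.* c) a b * + a)) - ∑ I (λ b → ∑ I (λ a → h c a b * + a))
      ≡⟨ cong₂ (λ x y → + 4 * x - y) (∑-swap I I _) (∑-swap I I _) ⟩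
    + 4 * τ M (2 ℕ.* c) (+_) K - τ M c (+_) K ∎
    where
    I = interval M
    h : ℕ → ℕ → ℕ → ℤ
    h c a b = δ (+ (c ℕ.* (a ℕ.* b)) - K)
    double : ∀ c a b → c ℕ.* ((a ℕ.+ a) ℕ.* b) ≡ 2 ℕ.* c ℕ.* (a ℕ.* b)
    double = ℕ-solver.solve-∀
    twice : ∀ x a → x * (a + a) ≡ + 2 * (x * a)
    twice = solve-∀
    twice-twice : ∀ x → + 2 * (+ 2 * x) ≡ + 4 * x
    twice-twice = solve-∀
    inner : ∀ b → 1 ≤ b → b ≤ M → ∑ I (λ a → h c a b * (+ a * parity a)) ≡
            + 4 * ∑ I (λ a → h (2 ℕ.* c) a b * + a) + - ∑ I (λ a → h c a b * + a)
    inner b 1≤b _ = begin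
      ∑ I (λ a → h c a b * (+ a * parity a))
        ≡⟨ ∑-cong I (λ a → ℤ.*-assoc (h c a b) (+ a) (parity a)) ⟨
      ∑ I (λ a → h c a b * + a * parity a)
        ≡⟨ ∑-parity M _ (λ a M<a → cong (_* + a) (δ-large _ K≤M
             (subst (M <_) (cong (c ℕ.*_) (ℕ.*-comm b a)) (factor-large 1≤c 1≤b M<a)))) ⟩
      + 2 * ∑ I (λ a → h c (a ℕ.+ a) b * + (a ℕ.+ a)) - ∑ I (λ a → h c a b * + a)
        ≡⟨ cong (λ t → + 2 * t - ∑ I (λ a → h c a b * + a)) (∑-cong I (λ a →
             trans (cong (λ z → δ (+ z - K) * + (a ℕ.+ a)) (double c a b)) (twice (h (2 ℕ.* c) a b) (+ a)))) ⟩
      + 2 * ∑ I (λ a → + 2 * (h (2 ℕ.* c) a b * + a)) - ∑ I (λ a → h c a b * + a)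
        ≡⟨ cong (λ t → + 2 * t - ∑ I (λ a → h c a b * + a)) (∑-* (+ 2) I _) ⟩
      + 2 * (+ 2 * ∑ I (λ a → h (2 ℕ.* c) a b * + a)) - ∑ I (λ a → h c a b * + a)
        ≡⟨ cong (_- ∑ I (λ a → h c a b * + a)) (twice-twice (∑ I (λ a → h (2 ℕ.* c) a b * + a))) ⟩
      + 4 * ∑ I (λ a → h (2 ℕ.* c) a b * + a) - ∑ I (λ a → h c a b * + a) ∎

  -- The sign (-1)^b is resolved first, then (-1)^a in both resulting sums: 8 = 2 · 4 and 6 = 2 + 4.
  τ-parityˡʳ :
    ∑ (interval M) (λ a → ∑ (interval M) (λ b → δ (+ (1 ℕ.* (a ℕ.* b)) - K) * (+ a * parity a * parity b)))
    ≡ + 8 * τ M 4 (+_) K - + 6 * τ M 2 (+_) K + τ M 1 (+_) K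
  τ-parityˡʳ = begin
    ∑ I (λ a → ∑ I (λ b → δ (+ (1 ℕ.* (a ℕ.* b)) - K) * (+ a * parity a * parity b)))
      ≡⟨ τ-parityʳ 1 w (s≤s z≤n) ⟩
    + 2 * τ M 2 w K - τ M 1 w K
      ≡⟨ cong₂ (λ x y → + 2 * x - y) (τ-parityˡ 2 (s≤s z≤n)) (τ-parityˡ 1 (s≤s z≤n)) ⟩
    + 2 * (+ 4 * τ M 4 (+_) K - τ M 2 (+_) K) - (+ 4 * τ M 2 (+_) K - τ M 1 (+_) K)
      ≡⟨ collect (τ M 4 (+_) K) (τ M 2 (+_) K) (τ M 1 (+_) K) ⟩
    + 8 * τ M 4 (+_) K - + 6 * τ M 2 (+_) K + τ M 1 (+_) K ∎
    where
    I = interval M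
    w : ℕ → ℤ
    w a = + a * parity a
    collect : ∀ x y z → + 2 * (+ 4 * x - y) - (+ 4 * y - z) ≡ + 8 * x - + 6 * y + z
    collect = solve-∀

-- The Liouville-type identity for the form x (x + ε).

quadraticForm : ℤ → ℤ → ℤ
quadraticForm ε x = x * (x + ε)

-- The hypotheses are the facts that are proved separately for ε = 0 and ε = 1: `odd-sum` evaluates
-- the terms with f = 0, the others bound the supports and the translations.
module Liouville
  (ε : ℤ)
  (∣ε∣≤1 : ∣ ε ∣ ≤ 1)
  (Q-nonneg : ∀ x → quadraticForm ε x ≡ + ∣ quadraticForm ε x ∣)
  (∣x∣≤1+Q : ∀ x → ∣ x ∣ ≤ suc ∣ quadraticForm ε x ∣)
  (odd-sum : ∀ n L → ∣ n + n + ε ∣ ≤ L →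
    ∑ (interval L) (λ e → (+ 1 - parity e) * (pos (n + n + ε - + e) + pos (- (n + n + ε) - + e)))
    ≡ + 2 * quadraticForm ε n)
  (C : ℕ) where

  Q : ℤ → ℤ
  Q = quadraticForm ε

  -- The factor `pos d` encodes d ≥ 1 as a weight, so that d can be translated inside ℤ. Both
  -- substitutions leave e unchanged, so e stays a natural number.
  term : ℤ → ℤ → ℕ → ℤ
  term x d e = δ (Q x + d * + e - + C) * ((sgn (d + + e + ε) - parity e) * pos d)

  term-nonpos : ∀ x k e → term x (- + k) e ≡ + 0
  term-nonpos x k e = trans (cong (λ p → D * (S * p)) (pos-nonpos k))
    (trans (cong (D *_) (ℤ.*-zeroʳ S)) (ℤ.*-zeroʳ D))
    where
    D = δ (Q x + - + k * + e - + C)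
    S = sgn (- + k + + e + ε) - parity e

  -- For d ≤ 0 the weight is 0. For d ≥ 1 the condition Q x + d e = C with Q x ≥ 0 bounds d, e and Q
  -- x by C, and the bound on Q x bounds x.
  term-support : ∀ x d e → 1 ≤ e → C < e ⊎ suc C < ∣ x ∣ ⊎ C < ∣ d ∣ → term x d e ≡ + 0
  term-support x -[1+ k ]  e _ _ = term-nonpos x (suc k) e
  term-support x (+ zero)  e _ _ = term-nonpos x 0 e
  term-support x (+ suc k) e@(suc _) _ out = δ-*-zero (Q x + + suc k * + e - + C) (⊥-elim ∘ absurd out)
    where
    absurd : C < e ⊎ suc C < ∣ x ∣ ⊎ C < suc k → Q x + + suc k * + e - + C ≢ + 0
    absurd out eq = contra out
      where
      q+de≡C : ∣ Q x ∣ ℕ.+ suc k ℕ.* e ≡ C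
      q+de≡C = ℤ.+-injective (trans (cong₂ _+_ (sym (Q-nonneg x)) (ℤ.pos-* (suc k) e))
                 (ℤ.i-j≡0⇒i≡j _ (+ C) eq))
      de≤C : suc k ℕ.* e ≤ C
      de≤C = subst (suc k ℕ.* e ≤_) q+de≡C (ℕ.m≤n+m _ ∣ Q x ∣)
      contra : C < e ⊎ suc C < ∣ x ∣ ⊎ C < suc k → _
      contra (inj₁ C<e)        = ℕ.<⇒≱ C<e (ℕ.≤-trans (ℕ.m≤m+n e (k ℕ.* e)) de≤C)
      contra (inj₂ (inj₁ C<x)) = ℕ.<⇒≱ C<x (ℕ.≤-trans (∣x∣≤1+Q x)
                                   (s≤s (subst (∣ Q x ∣ ≤_) q+de≡C (ℕ.m≤m+n _ _))))
      contra (inj₂ (inj₂ C<d)) = ℕ.<⇒≱ C<d (ℕ.≤-trans (ℕ.m≤m*n (suc k) e) de≤C)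

  -- Nonzero terms have |x| ≤ C + 1 and d ≤ C. The variable x is translated by e ≤ C, and d by at
  -- most |2n + ε| + e ≤ 2R + 1 + C. The two bounds add the margin to the support.
  module _ {R D} (R-large : suc C ℕ.+ C ≤ R) (D-large : C ℕ.+ (R ℕ.+ R ℕ.+ 1 ℕ.+ C) ≤ D) where

    C≤D : C ≤ D
    C≤D = ℕ.≤-trans (ℕ.m≤m+n C _) D-large

    K≤D : ∀ x → + C - Q x ℤ.≤ + D
    K≤D x = subst (λ q → + C - q ℤ.≤ + D) (sym (Q-nonneg x))
      (ℤ.≤-trans (ℤ.i-j≤i (+ C) (+ ∣ Q x ∣)) (ℤ.+≤+ C≤D))

    T : ℕ → ℤ → ℤ
    T c x = τ D c (+_) (+ C - Q x)

    V : ℤ → ℤ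
    V x = ∑ (interval D) λ e → ∑ (interval D) λ d → term x (+ d) e

    -- The sign (-1)^(d+e+ε) is a product of signs, so V x consists of two alternating sums over the
    -- factorisations d e = C - Q x.
    V-value : ∀ x → V x ≡ sgn ε * (+ 8 * T 4 x - + 6 * T 2 x + T 1 x) - (+ 2 * T 2 x - T 1 x)
    V-value x = begin
      ∑ I (λ e → ∑ I (λ d → term x (+ d) e))
        ≡⟨ ∑-swap I I _ ⟩
      ∑ I (λ d → ∑ I (λ e → term x (+ d) e))
        ≡⟨ ∑-cong I (λ d → trans (∑-cong I (pointwise d)) (∑-+ I _ _)) ⟩
      ∑ I (λ d → ∑ I (λ e → sgn ε * (h d e * (+ d * parity d * parity e)))
               + ∑ I (λ e → - (h d e * (+ d * parity e))))
        ≡⟨ ∑-+ I _ _ ⟩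
      ∑ I (λ d → ∑ I (λ e → sgn ε * (h d e * (+ d * parity d * parity e))))
      + ∑ I (λ d → ∑ I (λ e → - (h d e * (+ d * parity e))))
        ≡⟨ cong₂ _+_ (trans (∑-cong I (λ d → ∑-* (sgn ε) I _)) (∑-* (sgn ε) I _))
                     (trans (∑-cong I (λ d → ∑-neg I _)) (∑-neg I _)) ⟩
      sgn ε * ∑ I (λ d → ∑ I (λ e → h d e * (+ d * parity d * parity e)))
      - ∑ I (λ d → ∑ I (λ e → h d e * (+ d * parity e)))
        ≡⟨ cong₂ (λ a b → sgn ε * a - b) (τ-parityˡʳ (K≤D x)) (τ-parityʳ (K≤D x) 1 (+_) (s≤s z≤n)) ⟩
      sgn ε * (+ 8 * T 4 x - + 6 * T 2 x + T 1 x) - (+ 2 * T 2 x - T 1 x) ∎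
      where
      I = interval D
      h : ℕ → ℕ → ℤ
      h d e = δ (+ (1 ℕ.* (d ℕ.* e)) - (+ C - Q x))
      move : ∀ q de c → q + de - c ≡ de - (c - q)
      move = solve-∀
      expand : ∀ h p p′ s d → h * ((p * p′ * s - p′) * d) ≡ s * (h * (d * p * p′)) + - (h * (d * p′))
      expand = solve-∀
      pointwise : ∀ d e → term x (+ d) e ≡
        sgn ε * (h d e * (+ d * parity d * parity e)) + - (h d e * (+ d * parity e))
      pointwise d e = begin
        δ (Q x + + d * + e - + C) * ((sgn (+ d + + e + ε) - parity e) * + d)
          ≡⟨ cong₂ (λ z s → δ z * ((s - parity e) * + d))
               (trans (cong (λ y → Q x + y - + C) (trans (sym (ℤ.pos-* d e)) (cong +_ (sym (ℕ.*-identityˡ (d ℕ.* e))))))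
                      (move (Q x) _ (+ C)))
               (trans (sgn-+ (+ d + + e) ε) (cong (_* sgn ε) (sgn-+ (+ d) (+ e)))) ⟩
        h d e * ((parity d * parity e * sgn ε - parity e) * + d)
          ≡⟨ expand (h d e) (parity d) (parity e) (sgn ε) (+ d) ⟩
        sgn ε * (h d e * (+ d * parity d * parity e)) + - (h d e * (+ d * parity e)) ∎

    -- Cutting e down to at most C keeps the translations in `substitute` bounded.
    V-as-ℤ-sum : ∀ x → V x ≡ ∑ (interval C) λ e → ∑ (symmetric D) λ d → term x d e
    V-as-ℤ-sum x = begin
      ∑ (interval D) (λ e → ∑ (interval D) (λ d → term x (+ d) e))
        ≡⟨ ∑-interval-extend _ (λ e C<e → ∑-zero (interval D)
             (λ d → term-support x (+ d) e (ℕ.≤-trans (s≤s z≤n) C<e) (inj₁ C<e))) C≤D ⟩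
      ∑ (interval C) (λ e → ∑ (interval D) (λ d → term x (+ d) e))
        ≡⟨ ∑-cong (interval C) (λ e → sym (begin
             ∑ (symmetric D) (λ d → term x d e)
               ≡⟨ ∑-symmetric-split D _ ⟩
             term x (+ 0) e + (∑ (interval D) (λ d → term x (+ d) e) + ∑ (interval D) (λ d → term x (- + d) e))
               ≡⟨ cong₂ (λ a b → a + (∑ (interval D) (λ d → term x (+ d) e) + b))
                    (term-nonpos x 0 e) (∑-zero (interval D) (λ d → term-nonpos x d e)) ⟩
             + 0 + (∑ (interval D) (λ d → term x (+ d) e) + + 0)
               ≡⟨ trans (ℤ.+-identityˡ _) (ℤ.+-identityʳ _) ⟩
             ∑ (interval D) (λ d → term x (+ d) e) ∎)) ⟩
      ∑ (interval C) (λ e → ∑ (symmetric D) (λ d → term x d e)) ∎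

    -- For each e the change of variables is triangular: x is translated by `X e` while d is fixed,
    -- then d by `Y n e` while n is fixed.
    substitute : ∀ (X : ℕ → ℤ) (Y : ℤ → ℕ → ℤ) → (∀ e → ∣ X e ∣ ≤ e) →
      (∀ n e → ∣ n ∣ ≤ R → e ≤ C → ∣ Y n e ∣ ≤ R ℕ.+ R ℕ.+ 1 ℕ.+ C) →
      ∑ (symmetric R) V ≡
      ∑ (symmetric R) λ n → ∑ (interval D) λ e → ∑ (symmetric D) λ f → term (n + X e) (f + Y n e) e
    substitute X Y X≤ Y≤ = begin
      ∑ S V
        ≡⟨ ∑-cong S V-as-ℤ-sum ⟩
      ∑ S (λ x → ∑ I (λ e → ∑ J (λ d → term x d e)))
        ≡⟨ trans (∑-swap S I _) (∑-cong I (λ e → ∑-swap S J _)) ⟩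
      ∑ I (λ e → ∑ J (λ d → ∑ S (λ x → term x d e)))
        ≡⟨ ∑-interval-cong C (λ e 1≤e e≤C → ∑-cong J (λ d → sym
             (∑-symmetric-shift (λ x → term x d e) (X e) (λ x C<x → term-support x d e 1≤e (inj₂ (inj₁ C<x)))
               (ℕ.≤-trans (ℕ.+-monoʳ-≤ (suc C) (ℕ.≤-trans (X≤ e) e≤C)) R-large)))) ⟩
      ∑ I (λ e → ∑ J (λ d → ∑ S (λ n → term (n + X e) d e)))
        ≡⟨ trans (∑-swap S I _) (∑-cong I (λ e → ∑-swap S J _)) ⟨
      ∑ S (λ n → ∑ I (λ e → ∑ J (λ d → term (n + X e) d e)))
        ≡⟨ ∑-symmetric-cong R (λ n n≤R → ∑-interval-cong C (λ e 1≤e e≤C → sym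
             (∑-symmetric-shift (λ d → term (n + X e) d e) (Y n e)
               (λ d C<d → term-support (n + X e) d e 1≤e (inj₂ (inj₂ C<d)))
               (ℕ.≤-trans (ℕ.+-monoʳ-≤ C (Y≤ n e n≤R e≤C)) D-large)))) ⟩
      ∑ S (λ n → ∑ I (λ e → ∑ J (λ f → term (n + X e) (f + Y n e) e)))
        -- The range of e returns to D, the bound used for f, so that e and f can be exchanged
        -- later.
        ≡⟨ ∑-cong S (λ n → ∑-interval-extend _ (λ e C<e → ∑-zero J
             (λ f → term-support (n + X e) (f + Y n e) e (ℕ.≤-trans (s≤s z≤n) C<e) (inj₁ C<e))) C≤D) ⟨
      ∑ S (λ n → ∑ (interval D) (λ e → ∑ J (λ f → term (n + X e) (f + Y n e) e))) ∎
      where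
      S = symmetric R
      I = interval C
      J = symmetric D

    μ : ℤ → ℤ
    μ n = n + n + ε

    μ-bound : ∀ n → ∣ n ∣ ≤ R → ∣ μ n ∣ ≤ R ℕ.+ R ℕ.+ 1
    μ-bound n n≤R = ℕ.≤-trans (ℤ.∣i+j∣≤∣i∣+∣j∣ (n + n) ε)
      (ℕ.+-mono-≤ (ℕ.≤-trans (ℤ.∣i+j∣≤∣i∣+∣j∣ n n) (ℕ.+-mono-≤ n≤R n≤R)) ∣ε∣≤1)

    minus-bound : ∀ z e → ∣ z ∣ ≤ R ℕ.+ R ℕ.+ 1 → e ≤ C → ∣ z - + e ∣ ≤ R ℕ.+ R ℕ.+ 1 ℕ.+ C
    minus-bound z e z≤ e≤C = ℕ.≤-trans (ℤ.∣i-j∣≤∣i∣+∣j∣ z (+ e)) (ℕ.+-mono-≤ z≤ e≤C)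

    h : ℤ → ℕ → ℤ → ℤ
    h n e f = δ (Q n + f * + e - + C)

    windmill⁻ : ∑ (symmetric R) V ≡
      ∑ (symmetric R) λ n → ∑ (interval D) λ e → ∑ (symmetric D) λ f →
        h n e f * ((sgn f - parity e) * pos (f - + e + μ n))
    windmill⁻ = trans
      (substitute (λ e → - + e) (λ n e → μ n - + e) (λ e → ℕ.≤-reflexive (ℤ.∣-i∣≡∣i∣ (+ e)))
        (λ n e n≤R → minus-bound (μ n) e (μ-bound n n≤R)))
      (∑-cong (symmetric R) λ n → ∑-cong (interval D) λ e → ∑-cong (symmetric D) λ f →
        cong₂ (λ z s → δ (z - + C) * s) (quadratic n (+ e) f ε)
          (cong₂ (λ s p → (s - parity e) * pos p)
            -- Here d + e + ε exceeds f by the even number 2 (n + ε), so the parity of f alone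
            -- remains.
            (trans (cong sgn (sign n (+ e) f ε)) (sgn-even-shift f (n + ε))) (linear n (+ e) f ε)))
      where
      quadratic : ∀ n e f ε → (n + - e) * ((n + - e) + ε) + (f + (n + n + ε - e)) * e ≡ n * (n + ε) + f * e
      quadratic = solve-∀
      sign : ∀ n e f ε → f + (n + n + ε - e) + e + ε ≡ f + ((n + ε) + (n + ε))
      sign = solve-∀
      linear : ∀ n e f ε → f + (n + n + ε - e) ≡ f - e + (n + n + ε)
      linear = solve-∀

    windmill⁺ : ∑ (symmetric R) V ≡
      ∑ (symmetric R) λ n → ∑ (interval D) λ e → ∑ (symmetric D) λ f →
        h n e f * ((sgn f - parity e) * pos (f - + e - μ n))
    windmill⁺ = trans
      (substitute (λ e → + e) (λ n e → - μ n - + e) (λ e → ℕ.≤-refl)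
        (λ n e n≤R → minus-bound (- μ n) e (subst (_≤ _) (sym (ℤ.∣-i∣≡∣i∣ (μ n))) (μ-bound n n≤R))))
      (∑-cong (symmetric R) λ n → ∑-cong (interval D) λ e → ∑-cong (symmetric D) λ f →
        cong₂ (λ z s → δ (z - + C) * s) (quadratic n (+ e) f ε)
          (cong₂ (λ s p → (s - parity e) * pos p)
            (trans (cong sgn (sign n (+ e) f ε)) (sgn-even-shift f (- n))) (linear n (+ e) f ε)))
      where
      quadratic : ∀ n e f ε → (n + e) * ((n + e) + ε) + (f + (- (n + n + ε) - e)) * e ≡ n * (n + ε) + f * e
      quadratic = solve-∀
      sign : ∀ n e f ε → f + (- (n + n + ε) - e) + e + ε ≡ f + (- n + - n)
      sign = solve-∀
      linear : ∀ n e f ε → f + (- (n + n + ε) - e) ≡ f - e - (n + n + ε)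
      linear = solve-∀

    module _ (n : ℤ) where

      m = μ n
      I = interval D

      G : ℕ → ℤ → ℤ
      G e f = h n e f * ((sgn f - parity e) * (pos (f - + e + m) + pos (f - + e - m)))

      -- Both arguments -i - e ± m and the indicator are symmetric in e and i, while the sign factor
      -- is antisymmetric.
      negative-part : ∑ I (λ e → ∑ I (λ i → G e (- + i))) ≡ + 0
      negative-part = ∑-antisymmetric D (λ e i → G e (- + i)) anti
        where
        swap-δ : ∀ q e i c → q + - i * e - c ≡ q + - e * i - c
        swap-δ = solve-∀
        swap⁺ : ∀ e i m → - i - e + m ≡ - e - i + m
        swap⁺ = solve-∀
        swap⁻ : ∀ e i m → - i - e - m ≡ - e - i - m
        swap⁻ = solve-∀
        negate : ∀ h p p′ w → h * ((p - p′) * w) ≡ - (h * ((p′ - p) * w))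
        negate = solve-∀
        anti : ∀ e i → G e (- + i) ≡ - G i (- + e)
        anti e i = begin
          δ (Q n + - + i * + e - + C) * ((sgn (- + i) - parity e) * (pos (- + i - + e + m) + pos (- + i - + e - m)))
            ≡⟨ cong₂ (λ z w → δ z * ((sgn (- + i) - parity e) * w)) (swap-δ (Q n) (+ e) (+ i) (+ C))
                 (cong₂ (λ a b → pos a + pos b) (swap⁺ (+ e) (+ i) m) (swap⁻ (+ e) (+ i) m)) ⟩
          h n i (- + e) * ((sgn (- + i) - parity e) * w)
            ≡⟨ cong₂ (λ p p′ → h n i (- + e) * ((p - p′) * w)) (sgn-neg (+ i)) (sym (sgn-neg (+ e))) ⟩
          h n i (- + e) * ((parity i - sgn (- + e)) * w)
            ≡⟨ negate (h n i (- + e)) (parity i) (sgn (- + e)) w ⟩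
          - G i (- + e) ∎
          where
          w = pos (- + e - + i + m) + pos (- + e - + i - m)

      private
        swap-δ : ∀ q e i c → q + i * e - c ≡ q + e * i - c
        swap-δ = solve-∀

      -- By pos (- z) = pos z - z, a positive part may be replaced by half its argument
      -- modulo antisymmetric terms.
      positive-part-linear : ∑ I (λ e → ∑ I (λ i → G e (+ i))) ≡
        ∑ I (λ e → ∑ I (λ i → h n e (+ i) * ((parity i - parity e) * (+ i - + e))))
      positive-part-linear = ℤ.i-j≡0⇒i≡j _ _ (begin
        ∑ I (λ e → ∑ I (λ i → G e (+ i))) - ∑ I (λ e → ∑ I (L e))
          ≡⟨ cong (_+_ (∑ I (λ e → ∑ I (λ i → G e (+ i)))))
               (trans (sym (∑-neg I _)) (∑-cong I (λ e → sym (∑-neg I (L e))))) ⟩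
        ∑ I (λ e → ∑ I (λ i → G e (+ i))) + ∑ I (λ e → ∑ I (λ i → - L e i))
          ≡⟨ trans (sym (∑-+ I _ _)) (∑-cong I (λ e → sym (∑-+ I _ _))) ⟩
        ∑ I (λ e → ∑ I (λ i → G e (+ i) - L e i))
          ≡⟨ ∑-antisymmetric D (λ e i → G e (+ i) - L e i) anti ⟩
        + 0 ∎)
        where
        L : ℕ → ℕ → ℤ
        L e i = h n e (+ i) * ((parity i - parity e) * (+ i - + e))
        neg⁺ : ∀ e i m → i - e + m ≡ - (e - i - m)
        neg⁺ = solve-∀
        neg⁻ : ∀ e i m → i - e - m ≡ - (e - i + m)
        neg⁻ = solve-∀
        collect : ∀ h p p′ a b e i m →
          h * ((p - p′) * ((a - (e - i - m)) + (b - (e - i + m)))) - h * ((p - p′) * (i - e)) ≡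
          - (h * ((p′ - p) * (b + a)) - h * ((p′ - p) * (e - i)))
        collect = solve-∀
        anti : ∀ e i → G e (+ i) - L e i ≡ - (G i (+ e) - L i e)
        anti e i = begin
          G e (+ i) - L e i
            -- The exchange of e and i carries the argument with +m to the negative of the one with
            -- -m, and conversely. This is where the sum of both substitutions is essential.
            ≡⟨ cong₂ (λ z w → δ z * ((parity i - parity e) * w) - δ z * ((parity i - parity e) * (+ i - + e)))
                 (swap-δ (Q n) (+ e) (+ i) (+ C))
                 (cong₂ _+_ (trans (cong pos (neg⁺ (+ e) (+ i) m)) (pos-neg (+ e - + i - m)))
                            (trans (cong pos (neg⁻ (+ e) (+ i) m)) (pos-neg (+ e - + i + m)))) ⟩
          h n i (+ e) * ((parity i - parity e) *
            ((pos (+ e - + i - m) - (+ e - + i - m)) + (pos (+ e - + i + m) - (+ e - + i + m))))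
          - h n i (+ e) * ((parity i - parity e) * (+ i - + e))
            ≡⟨ collect (h n i (+ e)) (parity i) (parity e) (pos (+ e - + i - m)) (pos (+ e - + i + m)) (+ e) (+ i) m ⟩
          - (G i (+ e) - L i e) ∎

      -- The product ((-1)^i - (-1)^e) (i - e) splits into `E e i + E i e`, so the double sum is
      -- twice that of `E`. There `T 1` cancels, and 2 · (4 - 2) = 4 is left.
      positive-part : ∑ I (λ e → ∑ I (λ i → G e (+ i))) ≡ + 4 * T 2 n
      positive-part = begin
        ∑ I (λ e → ∑ I (λ i → G e (+ i)))
          ≡⟨ positive-part-linear ⟩
        ∑ I (λ e → ∑ I (λ i → h n e (+ i) * ((parity i - parity e) * (+ i - + e))))
          ≡⟨ ∑-cong I (λ e → trans (∑-cong I (pointwise e)) (∑-+ I _ _)) ⟩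
        ∑ I (λ e → ∑ I (λ i → E e i) + ∑ I (λ i → E i e))
          ≡⟨ ∑-+ I _ _ ⟩
        ∑ I (λ e → ∑ I (λ i → E e i)) + ∑ I (λ e → ∑ I (λ i → E i e))
          ≡⟨ cong (_+_ (∑ I (λ e → ∑ I (λ i → E e i)))) (∑-swap I I (λ e i → E i e)) ⟩
        ∑ I (λ e → ∑ I (λ i → E e i)) + ∑ I (λ e → ∑ I (λ i → E e i))
          ≡⟨ cong (λ x → x + x) E-sum ⟩
        (+ 4 * T 2 n - T 1 n - (+ 2 * T 2 n - T 1 n)) + (+ 4 * T 2 n - T 1 n - (+ 2 * T 2 n - T 1 n))
          ≡⟨ collect (T 2 n) (T 1 n) ⟩
        + 4 * T 2 n ∎
        where
        k : ℕ → ℕ → ℤ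
        k a b = δ (+ (1 ℕ.* (a ℕ.* b)) - (+ C - Q n))
        E : ℕ → ℕ → ℤ
        E a b = k a b * (+ a * parity a) + - (k a b * (+ a * parity b))
        move : ∀ q ei c → q + ei - c ≡ ei - (c - q)
        move = solve-∀
        k-comm : ∀ a b → k a b ≡ k b a
        k-comm a b = cong (λ z → δ (+ (1 ℕ.* z) - (+ C - Q n))) (ℕ.*-comm a b)
        h≡k : ∀ e i → h n e (+ i) ≡ k i e
        h≡k e i = cong δ (trans (cong (λ y → Q n + y - + C)
          (trans (sym (ℤ.pos-* i e)) (cong +_ (sym (ℕ.*-identityˡ (i ℕ.* e)))))) (move (Q n) _ (+ C)))
        expand : ∀ k p p′ i e → k * ((p - p′) * (i - e)) ≡
          (k * (e * p′) + - (k * (e * p))) + (k * (i * p) + - (k * (i * p′)))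
        expand = solve-∀
        pointwise : ∀ e i → h n e (+ i) * ((parity i - parity e) * (+ i - + e)) ≡ E e i + E i e
        pointwise e i = begin
          h n e (+ i) * ((parity i - parity e) * (+ i - + e))
            ≡⟨ cong (_* ((parity i - parity e) * (+ i - + e))) (h≡k e i) ⟩
          k i e * ((parity i - parity e) * (+ i - + e))
            ≡⟨ expand (k i e) (parity i) (parity e) (+ i) (+ e) ⟩
          (k i e * (+ e * parity e) + - (k i e * (+ e * parity i))) + E i e
            ≡⟨ cong (λ z → (z * (+ e * parity e) + - (z * (+ e * parity i))) + E i e) (k-comm i e) ⟩
          E e i + E i e ∎
        collect : ∀ x y → (+ 4 * x - y - (+ 2 * x - y)) + (+ 4 * x - y - (+ 2 * x - y)) ≡ + 4 * x
        collect = solve-∀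
        E-sum : ∑ I (λ a → ∑ I (λ b → E a b)) ≡ + 4 * T 2 n - T 1 n - (+ 2 * T 2 n - T 1 n)
        E-sum = begin
          ∑ I (λ a → ∑ I (λ b → E a b))
            ≡⟨ trans (∑-cong I (λ a → ∑-+ I _ _)) (∑-+ I _ _) ⟩
          ∑ I (λ a → ∑ I (λ b → k a b * (+ a * parity a))) + ∑ I (λ a → ∑ I (λ b → - (k a b * (+ a * parity b))))
            ≡⟨ cong₂ _+_ (τ-parityˡ (K≤D n) 1 (s≤s z≤n))
                 (trans (∑-cong I (λ a → ∑-neg I _)) (trans (∑-neg I _)
                   (cong -_ (τ-parityʳ (K≤D n) 1 (+_) (s≤s z≤n))))) ⟩
          + 4 * T 2 n - T 1 n - (+ 2 * T 2 n - T 1 n) ∎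

      -- With f = 0 the condition becomes Q n = C and no longer involves e, so the indicator factors
      -- out of the sum over e.
      zero-part : ∣ m ∣ ≤ D → ∑ I (λ e → G e (+ 0)) ≡ δ (Q n - + C) * (+ 2 * Q n)
      zero-part m≤D = begin
        ∑ I (λ e → G e (+ 0))
          ≡⟨ ∑-cong I (λ e → cong₂ (λ z w → δ z * ((+ 1 - parity e) * w)) (at-zero (Q n) (+ e) (+ C))
               (cong₂ (λ a b → pos a + pos b) (arg⁺ (+ e) m) (arg⁻ (+ e) m))) ⟩
        ∑ I (λ e → δ (Q n - + C) * ((+ 1 - parity e) * (pos (m - + e) + pos (- m - + e))))
          ≡⟨ ∑-* (δ (Q n - + C)) I _ ⟩
        δ (Q n - + C) * ∑ I (λ e → (+ 1 - parity e) * (pos (m - + e) + pos (- m - + e)))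
          ≡⟨ cong (δ (Q n - + C) *_) (odd-sum n D m≤D) ⟩
        δ (Q n - + C) * (+ 2 * Q n) ∎
        where
        at-zero : ∀ q e c → q + + 0 * e - c ≡ q - c
        at-zero = solve-∀
        arg⁺ : ∀ e m → + 0 - e + m ≡ m - e
        arg⁺ = solve-∀
        arg⁻ : ∀ e m → + 0 - e - m ≡ - m - e
        arg⁻ = solve-∀

      G-sum : ∣ m ∣ ≤ D → ∑ I (λ e → ∑ (symmetric D) (G e)) ≡ δ (Q n - + C) * (+ 2 * Q n) + + 4 * T 2 n
      G-sum m≤D = begin
        ∑ I (λ e → ∑ (symmetric D) (G e))
          ≡⟨ ∑-cong I (λ e → ∑-symmetric-split D (G e)) ⟩
        ∑ I (λ e → G e (+ 0) + (∑ I (λ i → G e (+ i)) + ∑ I (λ i → G e (- + i))))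
          ≡⟨ trans (∑-+ I _ _) (cong (_+_ (∑ I (λ e → G e (+ 0)))) (∑-+ I _ _)) ⟩
        ∑ I (λ e → G e (+ 0)) + (∑ I (λ e → ∑ I (λ i → G e (+ i))) + ∑ I (λ e → ∑ I (λ i → G e (- + i))))
          ≡⟨ cong₂ _+_ (zero-part m≤D) (trans (cong₂ _+_ positive-part negative-part) (ℤ.+-identityʳ _)) ⟩
        δ (Q n - + C) * (+ 2 * Q n) + + 4 * T 2 n ∎

    -- The average of the two substitutions, kept doubled to stay inside ℤ.
    V-sum : + 2 * ∑ (symmetric R) V ≡ ∑ (symmetric R) λ n → δ (Q n - + C) * (+ 2 * Q n) + + 4 * T 2 n
    V-sum = begin
      + 2 * ∑ S V
        ≡⟨ double (∑ S V) ⟩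
      ∑ S V + ∑ S V
        ≡⟨ cong₂ _+_ windmill⁻ windmill⁺ ⟩
      ∑ S (λ n → ∑ I′ (λ e → ∑ J (λ f → a n e f))) + ∑ S (λ n → ∑ I′ (λ e → ∑ J (λ f → b n e f)))
        ≡⟨ trans (∑-cong S (λ n → trans (∑-cong I′ (λ e → ∑-+ J _ _)) (∑-+ I′ _ _))) (∑-+ S _ _) ⟨
      ∑ S (λ n → ∑ I′ (λ e → ∑ J (λ f → a n e f + b n e f)))
        ≡⟨ ∑-cong S (λ n → ∑-cong I′ (λ e → ∑-cong J (λ f →
             distrib (h n e f) (sgn f - parity e) (pos (f - + e + μ n)) (pos (f - + e - μ n))))) ⟩
      ∑ S (λ n → ∑ I′ (λ e → ∑ J (G n e)))
        ≡⟨ ∑-symmetric-cong R (λ n n≤R → G-sum n (ℕ.≤-trans (μ-bound n n≤R)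
             (ℕ.≤-trans (ℕ.m≤m+n _ C) (ℕ.≤-trans (ℕ.m≤n+m _ C) D-large)))) ⟩
      ∑ S (λ n → δ (Q n - + C) * (+ 2 * Q n) + + 4 * T 2 n) ∎
      where
      S = symmetric R
      I′ = interval D
      J = symmetric D
      a b : ℤ → ℕ → ℤ → ℤ
      a n e f = h n e f * ((sgn f - parity e) * pos (f - + e + μ n))
      b n e f = h n e f * ((sgn f - parity e) * pos (f - + e - μ n))
      double : ∀ x → + 2 * x ≡ x + x
      double = solve-∀
      distrib : ∀ h k p q → h * (k * p) + h * (k * q) ≡ h * (k * (p + q))
      distrib = solve-∀

    -- The summand on the left is V x in its form from `V-value`, minus the contribution of f > 0.
    -- It simplifies to 2 T 1 - 10 T 2 + 8 T 4 for ε = 0 and to 2 T 2 - 8 T 4 for ε = 1.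
    divisor-identity : ∑ (symmetric R) (λ x →
        sgn ε * (+ 8 * T 4 x - + 6 * T 2 x + T 1 x) - (+ 2 * T 2 x - T 1 x) - + 2 * T 2 x)
      ≡ ∑ (symmetric R) λ x → δ (Q x - + C) * + C
    divisor-identity = halve (begin
      ∑ S W + ∑ S W
        ≡⟨ ∑-+ S W W ⟨
      ∑ S (λ x → W x + W x)
        ≡⟨ ∑-cong S (λ x → trans (cong (λ v → (v - + 2 * T 2 x) + (v - + 2 * T 2 x)) (sym (V-value x)))
             (regroup (V x) (T 2 x))) ⟩
      ∑ S (λ x → + 2 * V x + - (+ 4 * T 2 x))
        ≡⟨ trans (∑-+ S _ _) (cong₂ _+_ (∑-* (+ 2) S V) (∑-neg S _)) ⟩
      + 2 * ∑ S V - ∑ S (λ x → + 4 * T 2 x)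
        ≡⟨ cong (_- ∑ S (λ x → + 4 * T 2 x)) (trans V-sum (∑-+ S _ _)) ⟩
      ∑ S (λ x → δ (Q x - + C) * (+ 2 * Q x)) + ∑ S (λ x → + 4 * T 2 x) - ∑ S (λ x → + 4 * T 2 x)
        ≡⟨ cancel (∑ S (λ x → δ (Q x - + C) * (+ 2 * Q x))) _ ⟩
      ∑ S (λ x → δ (Q x - + C) * (+ 2 * Q x))
        ≡⟨ ∑-cong S (λ x → δ-*-cong (Q x - + C) (λ eq → cong (+ 2 *_) (ℤ.i-j≡0⇒i≡j _ _ eq))) ⟩
      ∑ S (λ x → δ (Q x - + C) * (+ 2 * + C))
        ≡⟨ trans (∑-cong S (λ x → twice (δ (Q x - + C)) (+ C))) (∑-+ S _ _) ⟩
      ∑ S (λ x → δ (Q x - + C) * + C) + ∑ S (λ x → δ (Q x - + C) * + C) ∎)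
      where
      S = symmetric R
      W : ℤ → ℤ
      W x = sgn ε * (+ 8 * T 4 x - + 6 * T 2 x + T 1 x) - (+ 2 * T 2 x - T 1 x) - + 2 * T 2 x
      regroup : ∀ v t → (v - + 2 * t) + (v - + 2 * t) ≡ + 2 * v + - (+ 4 * t)
      regroup = solve-∀
      cancel : ∀ a b → a + b - b ≡ a
      cancel = solve-∀
      twice : ∀ d c → d * (+ 2 * c) ≡ d * c + d * c
      twice = solve-∀

-- The terms with f = 0, and the two forms ε = 0 and ε = 1.

pos-difference : ∀ {i e} → i ≤ e → pos (+ i - + e) ≡ + 0
pos-difference {i} {e} i≤e = trans (cong pos (trans (ℤ.m-n≡m⊖n i e) (ℤ.⊖-≤ i≤e))) (pos-nonpos (e ∸ i))

-- Only odd e contribute, with factor 2. The sums behind this are 1 + 3 + ... + (2b - 1) = b² for r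
-- = 0 and 2 + 4 + ... + 2b = b (b + 1) for r = 1. Passing from b to b + 1 adds a new largest entry;
-- the others are the old ones with e shifted by 2.
odd-sum-ℕ : ∀ {r} b L → r ≤ 1 → b ℕ.+ b ℕ.+ r ≤ L →
  ∑ (interval L) (λ e → (+ 1 - parity e) * pos (+ (b ℕ.+ b ℕ.+ r) - + e)) ≡ + 2 * + (b ℕ.* (b ℕ.+ r))
odd-sum-ℕ {r} zero L r≤1 _ = trans (∑-interval-cong L (λ e 1≤e _ →
    trans (cong ((+ 1 - parity e) *_) (pos-difference (ℕ.≤-trans r≤1 1≤e))) (ℤ.*-zeroʳ (+ 1 - parity e))))
  (∑-zero (interval L) (λ _ → refl))
odd-sum-ℕ {r} (suc b) (suc zero) r≤1 (s≤s le) rewrite ℕ.+-suc b b with () ← le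
odd-sum-ℕ {r} (suc b) (suc (suc L)) r≤1 (s≤s le) rewrite ℕ.+-suc b b = begin
  ∑ (interval (suc (suc L))) f
    ≡⟨ trans (∑-interval-snoc (suc L) f) (cong (_+_ (f 1)) (∑-interval-snoc L (f ∘ suc))) ⟩
  f 1 + (f 2 + ∑ (interval L) (λ e → f (suc (suc e))))
    ≡⟨ cong (λ s → f 1 + (f 2 + s)) (∑-cong (interval L) step) ⟩
  f 1 + (f 2 + ∑ (interval L) (λ e → (+ 1 - parity e) * pos (+ a - + e)))
    -- `f 1` is the new entry 2 (a + 1), and `f 2` vanishes because 2 is even.
    ≡⟨ cong (λ s → f 1 + (f 2 + s)) (odd-sum-ℕ b L r≤1 (ℕ.≤-pred le)) ⟩
  + 2 * + suc a + (+ 0 + + 2 * + (b ℕ.* (b ℕ.+ r)))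
    ≡⟨ cong (_+_ (+ 2 * + suc a)) (ℤ.+-identityˡ (+ 2 * + (b ℕ.* (b ℕ.+ r)))) ⟩
  + 2 * + suc a + + 2 * + (b ℕ.* (b ℕ.+ r))
    ≡⟨ ℤ.*-distribˡ-+ (+ 2) (+ suc a) (+ (b ℕ.* (b ℕ.+ r))) ⟨
  + 2 * + (suc a ℕ.+ b ℕ.* (b ℕ.+ r))
    ≡⟨ cong (λ z → + 2 * + z) (square b r) ⟩
  + 2 * + (suc b ℕ.* (suc b ℕ.+ r)) ∎
  where
  a = b ℕ.+ b ℕ.+ r
  f : ℕ → ℤ
  f e = (+ 1 - parity e) * pos (+ suc (suc a) - + e)
  square : ∀ b r → suc (b ℕ.+ b ℕ.+ r) ℕ.+ b ℕ.* (b ℕ.+ r) ≡ suc b ℕ.* (suc b ℕ.+ r)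
  square = ℕ-solver.solve-∀
  cancel : ∀ a e → + 2 + a - (+ 2 + e) ≡ a - e
  cancel = solve-∀
  step : ∀ e → f (suc (suc e)) ≡ (+ 1 - parity e) * pos (+ a - + e)
  step e = cong₂ (λ p z → (+ 1 - p) * pos z) (ℤ.neg-involutive (parity e)) (cancel (+ a) (+ e))

-- For negative x the witness b is - r - x.
reflect : ∀ r → r ≤ 1 → ∀ x → ∃ λ b → x * (x + + r) ≡ + (b ℕ.* (b ℕ.+ r)) × ∣ x ∣ ≤ suc b ×
  (x + x + + r ≡ + (b ℕ.+ b ℕ.+ r) ⊎ x + x + + r ≡ - + (b ℕ.+ b ℕ.+ r))
reflect r r≤1 (+ b) = b , sym (ℤ.pos-* b (b ℕ.+ r)) , ℕ.n≤1+n b , inj₁ refl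
reflect zero z≤n -[1+ b ] =
  suc b , cong (λ z → + (suc b ℕ.* z)) (sym (ℕ.+-identityʳ (suc b))) , ℕ.n≤1+n _ , inj₂ (cong -[1+_] (regroup b))
  where
  regroup : ∀ b → suc (b ℕ.+ b) ≡ b ℕ.+ suc b ℕ.+ 0
  regroup = ℕ-solver.solve-∀
reflect (suc zero) (s≤s z≤n) -[1+ b ] =
  b , trans (form (+ b)) (sym (ℤ.pos-* b (b ℕ.+ 1))) , ℕ.≤-refl , inj₂ (double (+ b))
  where
  form : ∀ b → - (+ 1 + b) * (- (+ 1 + b) + + 1) ≡ b * (b + + 1)
  form = solve-∀
  double : ∀ b → - (+ 1 + b) + - (+ 1 + b) + + 1 ≡ - (b + b + + 1)
  double = solve-∀

b≤b*[b+r] : ∀ b r → b ≤ b ℕ.* (b ℕ.+ r)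
b≤b*[b+r] zero    r = z≤n
b≤b*[b+r] (suc b) r = ℕ.m≤m*n (suc b) (suc b ℕ.+ r)

-- According to the sign of 2n + r, one of the two positive parts vanishes for every e; the other is
-- evaluated by `odd-sum-ℕ` at |2n + r| = 2b + r.
odd-sum : ∀ r → r ≤ 1 → ∀ n L → ∣ n + n + + r ∣ ≤ L →
  ∑ (interval L) (λ e → (+ 1 - parity e) * (pos (n + n + + r - + e) + pos (- (n + n + + r) - + e)))
  ≡ + 2 * (n * (n + + r))
odd-sum r r≤1 n L m≤L with reflect r r≤1 n
... | b , Q≡ , _ , inj₁ μ≡ rewrite μ≡ = begin
  ∑ (interval L) (λ e → (+ 1 - parity e) * (pos (+ a - + e) + pos (- + a - + e)))
    ≡⟨ ∑-cong (interval L) (λ e → cong ((+ 1 - parity e) *_)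
         (trans (cong (_+_ (pos (+ a - + e))) (negative e)) (ℤ.+-identityʳ _))) ⟩
  ∑ (interval L) (λ e → (+ 1 - parity e) * pos (+ a - + e))
    ≡⟨ odd-sum-ℕ b L r≤1 m≤L ⟩
  + 2 * + (b ℕ.* (b ℕ.+ r))
    ≡⟨ cong (+ 2 *_) Q≡ ⟨
  + 2 * (n * (n + + r)) ∎
  where
  a = b ℕ.+ b ℕ.+ r
  negative : ∀ e → pos (- + a - + e) ≡ + 0
  negative e = trans (cong pos (sym (ℤ.neg-distrib-+ (+ a) (+ e)))) (pos-nonpos (a ℕ.+ e))
... | b , Q≡ , _ , inj₂ μ≡ rewrite μ≡ = begin
  ∑ (interval L) (λ e → (+ 1 - parity e) * (pos (- + a - + e) + pos (- - + a - + e)))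
    ≡⟨ ∑-cong (interval L) (λ e → cong ((+ 1 - parity e) *_)
         (trans (cong₂ _+_ (negative e) (cong (λ z → pos (z - + e)) (ℤ.neg-involutive (+ a)))) (ℤ.+-identityˡ _))) ⟩
  ∑ (interval L) (λ e → (+ 1 - parity e) * pos (+ a - + e))
    ≡⟨ odd-sum-ℕ b L r≤1 (subst (_≤ L) (ℤ.∣-i∣≡∣i∣ (+ a)) m≤L) ⟩
  + 2 * + (b ℕ.* (b ℕ.+ r))
    ≡⟨ cong (+ 2 *_) Q≡ ⟨
  + 2 * (n * (n + + r)) ∎
  where
  a = b ℕ.+ b ℕ.+ r
  negative : ∀ e → pos (- + a - + e) ≡ + 0
  negative e = trans (cong pos (sym (ℤ.neg-distrib-+ (+ a) (+ e)))) (pos-nonpos (a ℕ.+ e))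

quadraticForm-nonneg : ∀ r → r ≤ 1 → ∀ x → quadraticForm (+ r) x ≡ + ∣ quadraticForm (+ r) x ∣
quadraticForm-nonneg r r≤1 x with reflect r r≤1 x
... | _ , Q≡ , _ = trans Q≡ (cong (λ z → + ∣ z ∣) (sym Q≡))

∣x∣≤1+quadraticForm : ∀ r → r ≤ 1 → ∀ x → ∣ x ∣ ≤ suc ∣ quadraticForm (+ r) x ∣
∣x∣≤1+quadraticForm r r≤1 x with reflect r r≤1 x
... | b , Q≡ , x≤ , _ = ℕ.≤-trans x≤ (s≤s (subst (b ≤_) (cong ∣_∣ (sym Q≡)) (b≤b*[b+r] b r)))

module Form (r : ℕ) (r≤1 : r ≤ 1) =
  Liouville (+ r) r≤1 (quadraticForm-nonneg r r≤1) (∣x∣≤1+quadraticForm r r≤1) (odd-sum r r≤1)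

-- The arithmetic function σ

δ-≡ : ∀ {m n} → m ≡ n → δ (+ m - + n) ≡ + 1
δ-≡ {m} refl = cong δ (ℤ.+-inverseʳ (+ m))

δ-≢ : ∀ {m n} → m ≢ n → δ (+ m - + n) ≡ + 0
δ-≢ m≢n = δ-≢0 (λ eq → m≢n (ℤ.+-injective (ℤ.i-j≡0⇒i≡j _ _ eq)))

δ-cong-⇔ : ∀ {m n m′ n′} → (m ≡ n → m′ ≡ n′) → (m′ ≡ n′ → m ≡ n) → δ (+ m - + n) ≡ δ (+ m′ - + n′)
δ-cong-⇔ {m} {n} f g with m ℕ.≟ n
... | yes eq = trans (δ-≡ eq) (sym (δ-≡ (f eq)))
... | no neq = trans (δ-≢ neq) (sym (δ-≢ (neq ∘ g)))

∑-applyUpTo-suc : ∀ n f → ∑ (applyUpTo suc n) f ≡ ∑ (interval n) f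
∑-applyUpTo-suc zero    f = refl
∑-applyUpTo-suc (suc n) f = begin
  ∑ (applyUpTo suc (suc n)) f              ≡⟨ cong (λ xs → ∑ xs f) (applyUpTo-∷ʳ suc n) ⟨
  ∑ (applyUpTo suc n ∷ʳ suc n) f           ≡⟨ ∑-++ (applyUpTo suc n) _ f ⟩
  ∑ (applyUpTo suc n) f + (f (suc n) + + 0) ≡⟨ cong₂ _+_ (∑-applyUpTo-suc n f) (ℤ.+-identityʳ _) ⟩
  ∑ (interval n) f + f (suc n)             ≡⟨ ℤ.+-comm _ (f (suc n)) ⟩
  ∑ (interval (suc n)) f                   ∎

sumℕ-filter : ∀ {P : ℕ → Set} (P? : Decidable P) xs →
  + sumℕ (filter P? xs) ≡ ∑ xs (λ x → if does (P? x) then + x else + 0)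
sumℕ-filter P? []       = refl
sumℕ-filter P? (x ∷ xs) with P? x
... | yes _ = cong (_+_ (+ x)) (sumℕ-filter P? xs)
... | no  _ = trans (sumℕ-filter P? xs) (sym (ℤ.+-identityˡ _))

-- A divisor a of q has exactly one cofactor b, and b ≤ q ≤ D puts it in the range; a non-divisor
-- has none.
τ-σℕ : ∀ {D} q → 1 ≤ q → q ≤ D → τ D 1 (+_) (+ q) ≡ + σℕ q
τ-σℕ {D} q@(suc q-1) 1≤q q≤D = begin
  ∑ (interval D) F
    ≡⟨ ∑-interval-extend F (λ a q<a → F-∤ a (λ a∣q → ℕ.<⇒≱ q<a (ℕ.∣⇒≤ a∣q))) q≤D ⟩
  ∑ (interval q) F
    ≡⟨ ∑-interval-cong q (λ a 1≤a _ → F-value a 1≤a (a ∣? q)) ⟩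
  ∑ (interval q) (λ a → if does (a ∣? q) then + a else + 0)
    ≡⟨ ∑-applyUpTo-suc q (λ a → if does (a ∣? q) then + a else + 0) ⟨
  ∑ (applyUpTo suc q) (λ a → if does (a ∣? q) then + a else + 0)
    ≡⟨ sumℕ-filter (_∣? q) (applyUpTo suc q) ⟨
  + σℕ q ∎
  where
  F : ℕ → ℤ
  F a = ∑ (interval D) (λ b → δ (+ (1 ℕ.* (a ℕ.* b)) - + q) * + a)
  normal : ∀ a b → 1 ℕ.* (a ℕ.* b) ≡ b ℕ.* a
  normal = ℕ-solver.solve-∀
  F-∤ : ∀ a → ¬ a ∣ q → F a ≡ + 0
  F-∤ a a∤q = ∑-zero (interval D) (λ b → cong (_* + a) (δ-≢ (λ eq →
    a∤q (divides b (trans (sym eq) (normal a b))))))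
  F-value : ∀ a → 1 ≤ a → (a∣?q : Dec (a ∣ q)) → F a ≡ (if does a∣?q then + a else + 0)
  F-value a         _ (no a∤q)               = F-∤ a a∤q
  F-value a@(suc _) _ (yes (divides b q≡ba)) = begin
    F a
      ≡⟨ ∑-interval-single D _ b (1≤b b q≡ba) (ℕ.≤-trans b≤q q≤D)
           (λ i i≢b → cong (_* + a) (δ-≢ (λ eq → i≢b
             (ℕ.*-cancelʳ-≡ i b a (trans (sym (normal a i)) (trans eq q≡ba)))))) ⟩
    δ (+ (1 ℕ.* (a ℕ.* b)) - + q) * + a
      ≡⟨ cong (_* + a) (δ-≡ (trans (normal a b) (sym q≡ba))) ⟩
    + 1 * + a
      ≡⟨ ℤ.*-identityˡ (+ a) ⟩
    + a ∎
    where
    1≤b : ∀ b → q ≡ b ℕ.* a → 1 ≤ b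
    1≤b (suc b) _ = s≤s z≤n
    b≤q : b ≤ q
    b≤q = subst (b ≤_) (sym q≡ba) (ℕ.m≤m*n b a)

σ-integer : ∀ q → σ (+ q / 1) ≡ σℕ q
σ-integer q = cong σ (ℚ.normalize-coprime (Coprimality.sym (Coprimality.1-coprimeTo q)))

σ-multiple : ∀ q c .{{_ : NonZero c}} → σ (+ (q ℕ.* c) / c) ≡ σℕ q
σ-multiple q c@(suc c-1) = trans
  (cong σ (ℚ.fromℚᵘ-cong {mkℚᵘ (+ (q ℕ.* c)) c-1} {mkℚᵘ (+ q) 0}
    (*≡* (trans (ℤ.*-identityʳ _) (ℤ.pos-* q c)))))
  (σ-integer q)

-- The reduced fraction p and the gcd g satisfy numerator · g = j and denominator · g = c. If the
-- denominator is 1, then g = c and c divides j. Generalising over p and g avoids unfolding the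
-- normalisation.
σ-nonmultiple : ∀ j c .{{_ : NonZero c}} → ¬ c ∣ j → σ (+ j / c) ≡ 0
σ-nonmultiple j c c∤j = fractional (+ j / c) (ℤ.gcd (+ j) (+ c)) (ℚ.↥-/ (+ j) c) (ℚ.↧-/ (+ j) c)
  where
  fractional : ∀ p g → ↥ p * g ≡ + j → ↧ p * g ≡ + c → σ p ≡ 0
  fractional (mkℚ (+ m) zero    _) g num den = ⊥-elim (c∤j (divides m (ℤ.+-injective
    (trans (sym num) (trans (cong (+ m *_) (trans (sym (ℤ.*-identityˡ g)) den)) (sym (ℤ.pos-* m c)))))))
  fractional (mkℚ (+ m) (suc _) _) g num den = refl
  fractional (mkℚ -[1+ _ ] _    _) g num den = refl

τ-σ : ∀ {D} c j .{{_ : NonZero c}} → 1 ≤ j → j ≤ D → τ D c (+_) (+ j) ≡ + σ (+ j / c)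
τ-σ {D} c j 1≤j j≤D with c ∣? j
... | no c∤j = trans (∑-zero (interval D) (λ a → ∑-zero (interval D) (λ b →
    cong (_* + a) (δ-≢ {c ℕ.* (a ℕ.* b)} {j} (λ eq → c∤j (divides (a ℕ.* b) (trans (sym eq) (ℕ.*-comm c _))))))))
  (cong +_ (sym (σ-nonmultiple j c c∤j)))
... | yes (divides-refl q) = begin
  τ D c (+_) (+ (q ℕ.* c))
    ≡⟨ ∑-cong (interval D) (λ a → ∑-cong (interval D) (λ b → cong (_* + a)
         (δ-cong-⇔ (λ eq → trans (ℕ.*-identityˡ _) (ℕ.*-cancelʳ-≡ (a ℕ.* b) q c (trans (ℕ.*-comm (a ℕ.* b) c) eq)))
                   (λ eq → trans (ℕ.*-comm c _) (cong (ℕ._* c) (trans (sym (ℕ.*-identityˡ _)) eq)))))) ⟩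
  τ D 1 (+_) (+ q)
    ≡⟨ τ-σℕ q (1≤q q 1≤j) (ℕ.≤-trans (ℕ.m≤m*n q c) j≤D) ⟩
  + σℕ q
    ≡⟨ cong +_ (σ-multiple q c) ⟨
  + σ (+ (q ℕ.* c) / c) ∎
  where
  1≤q : ∀ q → 1 ≤ q ℕ.* c → 1 ≤ q
  1≤q (suc q) _ = s≤s z≤n

-- σ⁺ c 0 is 0 although σ(0) = 1: the recurrence has no term with j = n.
σ⁺ : (c : ℕ) .{{_ : NonZero c}} → ℕ → ℤ
σ⁺ c zero      = + 0
σ⁺ c j@(suc _) = + σ (+ j / c)

-- For q ≥ N the integer N - q is at most 0 and has no factorisation into positive factors; the
-- truncated `N ∸ q` is then 0, where `σ⁺` is 0 too.
τ-σ⁺ : ∀ {D} c .{{_ : NonZero c}} N q → N ≤ D → τ D c (+_) (+ N - + q) ≡ σ⁺ c (N ∸ q)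
τ-σ⁺ {D} c N q N≤D with q ℕ.<? N
... | no q≮N = trans (∑-zero-interval λ a 1≤a → ∑-zero-interval λ b 1≤b → cong (_* + a) (δ-≢0 (nonzero a b 1≤a 1≤b)))
                     (cong (σ⁺ c) (sym (ℕ.m≤n⇒m∸n≡0 N≤q)))
  where
  N≤q = ℕ.≮⇒≥ q≮N
  ∑-zero-interval : ∀ {f} → (∀ a → 1 ≤ a → f a ≡ + 0) → ∑ (interval D) f ≡ + 0
  ∑-zero-interval f≡0 = trans (∑-interval-cong D (λ i 1≤i _ → f≡0 i 1≤i)) (∑-zero (interval D) (λ _ → refl))
  1≤product : ∀ c a b .{{_ : NonZero c}} → 1 ≤ a → 1 ≤ b → 1 ≤ c ℕ.* (a ℕ.* b)
  1≤product (suc c) (suc a) (suc b) _ _ = s≤s z≤n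
  nonzero : ∀ a b → 1 ≤ a → 1 ≤ b → + (c ℕ.* (a ℕ.* b)) - (+ N - + q) ≢ + 0
  nonzero a b 1≤a 1≤b eq = ℕ.<⇒≱ (1≤product c a b 1≤a 1≤b) (ℕ.+-cancelʳ-≤ q _ 0
    (subst (_≤ q) (ℤ.+-injective (sym (balance (+ (c ℕ.* (a ℕ.* b))) (+ N) (+ q) eq))) N≤q))
    where
    expand : ∀ p n q → p + q ≡ n + (p - (n - q))
    expand = solve-∀
    balance : ∀ p n q → p - (n - q) ≡ + 0 → p + q ≡ n
    balance p n q eq = trans (expand p n q) (trans (cong (_+_ n) eq) (ℤ.+-identityʳ n))
... | yes q<N = begin
  τ D c (+_) (+ N - + q)  ≡⟨ cong (τ D c (+_)) (trans (ℤ.m-n≡m⊖n N q) (ℤ.⊖-≥ (ℕ.<⇒≤ q<N))) ⟩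
  τ D c (+_) (+ (N ∸ q))  ≡⟨ τ-σ c (N ∸ q) (ℕ.m<n⇒0<n∸m q<N) (ℕ.≤-trans (ℕ.m∸n≤m N q) N≤D) ⟩
  + σ (+ (N ∸ q) / c)     ≡⟨ positive (N ∸ q) (ℕ.m<n⇒0<n∸m q<N) ⟨
  σ⁺ c (N ∸ q)            ∎
  where
  positive : ∀ j → 1 ≤ j → σ⁺ c j ≡ + σ (+ j / c)
  positive (suc j) _ = refl

-- Logarithmic derivatives of θ and ψ over finite ranges.

∑-rangeℤ : ∀ n f → ∑ (rangeℤ n) f ≡ ∑ (symmetric n) f
∑-rangeℤ n f = trans (∑-map _ (upTo (suc (n ℕ.+ n))) f) (go n)
  where
  go : ∀ n → ∑ (upTo (suc (n ℕ.+ n))) (λ i → f (+ i - + n)) ≡ ∑ (symmetric n) f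
  go zero    = refl
  go (suc n) rewrite ℕ.+-suc n n = begin
    f -[1+ n ] + ∑ (applyUpTo suc (suc m)) g
      ≡⟨ cong (λ xs → f -[1+ n ] + ∑ xs g) (map-upTo suc (suc m)) ⟨
    f -[1+ n ] + ∑ (map suc (upTo (suc m))) g
      ≡⟨ cong (_+_ (f -[1+ n ])) (∑-map suc (upTo (suc m)) g) ⟩
    f -[1+ n ] + ∑ (upTo (suc m)) (g ∘ suc)
      ≡⟨ cong (λ xs → f -[1+ n ] + ∑ xs (g ∘ suc)) (upTo-∷ʳ m) ⟨
    f -[1+ n ] + ∑ (upTo m ∷ʳ m) (g ∘ suc)
      ≡⟨ cong (_+_ (f -[1+ n ])) (∑-++ (upTo m) _ (g ∘ suc)) ⟩
    f -[1+ n ] + (∑ (upTo m) (g ∘ suc) + (g (suc m) + + 0))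
      ≡⟨ cong₂ (λ s z → f -[1+ n ] + (s + (f z + + 0)))
           (trans (∑-cong (upTo m) (λ i → cong f (shift (+ i) (+ n)))) (go n)) (last (+ n)) ⟩
    f -[1+ n ] + (∑ (symmetric n) f + (f (+ suc n) + + 0))
      ≡⟨ regroup (f -[1+ n ]) _ (f (+ suc n)) ⟩
    f (+ suc n) + (f -[1+ n ] + ∑ (symmetric n) f) ∎
    where
    m = suc (n ℕ.+ n)
    g : ℕ → ℤ
    g i = f (+ i - + suc n)
    shift : ∀ i n → + 1 + i - (+ 1 + n) ≡ i - n
    shift = solve-∀
    last : ∀ n → + 1 + (+ 1 + (n + n)) - (+ 1 + n) ≡ + 1 + n
    last = solve-∀
    regroup : ∀ a b c → a + (b + (c + + 0)) ≡ c + (a + b)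
    regroup = solve-∀

∑-rangeℕ : ∀ n f → ∑ (rangeℕ n) f ≡ f 0 + ∑ (interval n) f
∑-rangeℕ n f = cong (_+_ (f 0)) (∑-applyUpTo-suc n f)

-- With F = Σ q^(s x) over xs, this is q F′ = F · Σ G j q^j up to degree B (when G 0 = 0).
LogDerivative : ℕ → (A → ℕ) → List A → (ℕ → ℤ) → Set
LogDerivative B s xs G = ∀ n → n ≤ B →
  ∑ xs (λ x → δ (+ s x - + n) * + n) ≡ ∑ xs (λ x → G (n ∸ s x))

-- The coefficients of q θ′/θ and q ψ′/ψ, as read off from `divisor-identity`. For ε = 1 the sign
-- `sgn ε` = -1 removes `T 1`, and the remaining 2 T 2 - 8 T 4, taken at twice the degree, is 2
-- (σ(j) - 4 σ(j/2)).
G-square G-triangular : ℕ → ℤ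
G-square     j = + 2 * σ⁺ 1 j - + 10 * σ⁺ 2 j + + 8 * σ⁺ 4 j
G-triangular j = σ⁺ 1 j - + 4 * σ⁺ 2 j

square-nonneg : ∀ x → x * x ≡ + ∣ x * x ∣
square-nonneg (+ n)    = trans (sym (ℤ.pos-* n n)) (cong (+_ ∘ ∣_∣) (ℤ.pos-* n n))
square-nonneg -[1+ n ] = refl

∣x∣≤∣x*x∣ : ∀ x → ∣ x ∣ ≤ ∣ x * x ∣
∣x∣≤∣x*x∣ x = subst (∣ x ∣ ≤_) (trans (cong (∣ x ∣ ℕ.*_) (ℕ.+-identityʳ ∣ x ∣)) (sym (ℤ.abs-* x x)))
  (b≤b*[b+r] ∣ x ∣ 0)

square-logDerivative : ∀ B → LogDerivative B (λ x → ∣ x * x ∣) (rangeℤ B) G-square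
square-logDerivative B n n≤B = begin
  ∑ (rangeℤ B) L                     ≡⟨ ∑-rangeℤ B L ⟩
  ∑ (symmetric B) L                  ≡⟨ ∑-symmetric-extend L L≡0 (ℕ.m≤m+n B _) ⟨
  ∑ (symmetric R) L                  ≡⟨ ∑-cong (symmetric R) (λ x → cong (λ q → δ (q - + n) * + n) (form x)) ⟨
  ∑ (symmetric R) (λ x → δ (x * (x + + 0) - + n) * + n)
    ≡⟨ Form.divisor-identity 0 z≤n n {R} {D} (ℕ.m≤n+m _ B) ℕ.≤-refl ⟨
  ∑ (symmetric R) _                  ≡⟨ ∑-cong (symmetric R) value ⟩
  ∑ (symmetric R) (λ x → G-square (n ∸ ∣ x * x ∣))
    ≡⟨ ∑-symmetric-extend (λ x → G-square (n ∸ ∣ x * x ∣))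
         (λ x B<x → cong G-square (ℕ.m≤n⇒m∸n≡0 (ℕ.<⇒≤ (n<x² x B<x)))) (ℕ.m≤m+n B _) ⟩
  ∑ (symmetric B) (λ x → G-square (n ∸ ∣ x * x ∣))
    ≡⟨ ∑-rangeℤ B _ ⟨
  ∑ (rangeℤ B) (λ x → G-square (n ∸ ∣ x * x ∣)) ∎
  where
  -- R covers both the given range B and the demand of `R-large`; D is the least value that
  -- `D-large` admits.
  R = B ℕ.+ (suc n ℕ.+ n)
  D = n ℕ.+ (R ℕ.+ R ℕ.+ 1 ℕ.+ n)
  L : ℤ → ℤ
  L x = δ (+ ∣ x * x ∣ - + n) * + n
  n<x² : ∀ x → B < ∣ x ∣ → n < ∣ x * x ∣
  n<x² x B<x = ℕ.≤-<-trans n≤B (ℕ.<-≤-trans B<x (∣x∣≤∣x*x∣ x))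
  L≡0 : ∀ x → B < ∣ x ∣ → L x ≡ + 0
  L≡0 x B<x = cong (_* + n) (δ-≢ (ℕ.>⇒≢ (n<x² x B<x)))
  form : ∀ x → x * (x + + 0) ≡ + ∣ x * x ∣
  form x = trans (cong (x *_) (ℤ.+-identityʳ x)) (square-nonneg x)
  τ-value : ∀ c .{{_ : NonZero c}} x → τ D c (+_) (+ n - x * (x + + 0)) ≡ σ⁺ c (n ∸ ∣ x * x ∣)
  τ-value c x = trans (cong (λ q → τ D c (+_) (+ n - q)) (form x)) (τ-σ⁺ c n ∣ x * x ∣ (ℕ.m≤m+n n _))
  combine : ∀ a b c → + 1 * (+ 8 * c - + 6 * b + a) - (+ 2 * b - a) - + 2 * b ≡ + 2 * a - + 10 * b + + 8 * c
  combine = solve-∀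
  value : ∀ x → _ ≡ G-square (n ∸ ∣ x * x ∣)
  value x = trans (combine (τ D 1 (+_) (+ n - x * (x + + 0))) (τ D 2 (+_) (+ n - x * (x + + 0))) (τ D 4 (+_) (+ n - x * (x + + 0))))
    (cong₂ _+_ (cong₂ (λ a b → + 2 * a - + 10 * b) (τ-value 1 x) (τ-value 2 x)) (cong (+ 8 *_) (τ-value 4 x)))

triangle : ℕ → ℕ
triangle y = (y ℕ.* suc y) ℕ./ 2

2∣y*[1+y] : ∀ y → 2 ∣ y ℕ.* suc y
2∣y*[1+y] zero    = divides 0 refl
2∣y*[1+y] (suc y) = subst (2 ∣_) (step y) (ℕ.∣m∣n⇒∣m+n (2∣y*[1+y] y) (divides (suc y) refl))
  where
  step : ∀ y → y ℕ.* suc y ℕ.+ suc y ℕ.* 2 ≡ suc y ℕ.* suc (suc y)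
  step = ℕ-solver.solve-∀

triangle-double : ∀ y → triangle y ℕ.* 2 ≡ y ℕ.* suc y
triangle-double y = m/n*n≡m (2∣y*[1+y] y)

y≤triangle : ∀ y → y ≤ triangle y
y≤triangle zero        = z≤n
y≤triangle y@(suc y-1) = ℕ.*-cancelʳ-≤ y (triangle y) 2
  (subst (y ℕ.* 2 ≤_) (sym (triangle-double y)) (ℕ.*-monoʳ-≤ y (s≤s (s≤s z≤n))))

-- The integers y and -1 - y give the same product x (x + 1), so each y ≥ 0 is met twice. The radius
-- R + 1 makes room for -1 - y with y ≤ R.
∑-pronic : ∀ {B R} f → B ≤ R → (∀ y → B < y → f (+ (y ℕ.* suc y)) ≡ + 0) →
  ∑ (symmetric (suc R)) (λ x → f (x * (x + + 1))) ≡ + 2 * ∑ (rangeℕ B) (λ y → f (+ (y ℕ.* suc y)))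
∑-pronic {B} {R} f B≤R f≡0 = begin
  ∑ (symmetric (suc R)) F
    ≡⟨ ∑-symmetric-split (suc R) F ⟩
  F (+ 0) + (∑ (interval (suc R)) (λ i → F (+ i)) + ∑ (interval (suc R)) (λ i → F (- + i)))
    ≡⟨ cong₂ (λ a b → F (+ 0) + (a + b)) (∑-cong (interval (suc R)) F-pos)
         (trans (∑-interval-snoc R (λ i → F (- + i))) (cong₂ _+_ (F-neg 0) (∑-cong (interval R) F-neg))) ⟩
  g 0 + (∑ (interval (suc R)) g + (g 0 + ∑ (interval R) g))
    ≡⟨ cong₂ (λ a b → g 0 + (a + (g 0 + b))) (∑-interval-extend g f≡0 (ℕ.m≤n⇒m≤1+n B≤R)) (∑-interval-extend g f≡0 B≤R) ⟩
  g 0 + (∑ (interval B) g + (g 0 + ∑ (interval B) g))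
    ≡⟨ regroup (g 0) _ ⟩
  + 2 * (g 0 + ∑ (interval B) g)
    ≡⟨ cong (+ 2 *_) (∑-rangeℕ B g) ⟨
  + 2 * ∑ (rangeℕ B) g ∎
  where
  F : ℤ → ℤ
  F x = f (x * (x + + 1))
  g : ℕ → ℤ
  g y = f (+ (y ℕ.* suc y))
  F-pos : ∀ i → F (+ i) ≡ g i
  F-pos i = cong f (trans (sym (ℤ.pos-* i (i ℕ.+ 1))) (cong (λ z → + (i ℕ.* z)) (ℕ.+-comm i 1)))
  reflection : ∀ i → - (+ 1 + i) * (- (+ 1 + i) + + 1) ≡ i * (i + + 1)
  reflection = solve-∀
  F-neg : ∀ i → F (- + suc i) ≡ g i
  F-neg i = trans (cong f (reflection (+ i))) (F-pos i)
  regroup : ∀ a b → a + (b + (a + b)) ≡ + 2 * (a + b)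
  regroup = solve-∀

-- The equation 2 c a b + 2 t = 2 n is divided by 2. Moving t to the left first keeps both sides
-- natural numbers, even when n < t.
τ-double : ∀ D c w n t → τ D (2 ℕ.* c) w (+ (n ℕ.* 2) - + (t ℕ.* 2)) ≡ τ D c w (+ n - + t)
τ-double D c w n t = ∑-cong (interval D) λ a → ∑-cong (interval D) λ b → cong (_* w a) (begin
  δ (+ (2 ℕ.* c ℕ.* (a ℕ.* b)) - (+ (n ℕ.* 2) - + (t ℕ.* 2)))
    ≡⟨ cong δ (move (+ (2 ℕ.* c ℕ.* (a ℕ.* b))) (+ (n ℕ.* 2)) (+ (t ℕ.* 2))) ⟩
  δ (+ (2 ℕ.* c ℕ.* (a ℕ.* b) ℕ.+ t ℕ.* 2) - + (n ℕ.* 2))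
    ≡⟨ δ-cong-⇔ (λ eq → ℕ.*-cancelʳ-≡ _ n 2 (trans (sym (factor c (a ℕ.* b) t)) eq))
                (λ eq → trans (factor c (a ℕ.* b) t) (cong (ℕ._* 2) eq)) ⟩
  δ (+ (c ℕ.* (a ℕ.* b) ℕ.+ t) - + n)
    ≡⟨ cong δ (move (+ (c ℕ.* (a ℕ.* b))) (+ n) (+ t)) ⟨
  δ (+ (c ℕ.* (a ℕ.* b)) - (+ n - + t)) ∎)
  where
  move : ∀ z n t → z - (n - t) ≡ z + t - n
  move = solve-∀
  factor : ∀ c z t → 2 ℕ.* c ℕ.* z ℕ.+ t ℕ.* 2 ≡ (c ℕ.* z ℕ.+ t) ℕ.* 2
  factor = ℕ-solver.solve-∀

-- The factor 4 has two sources: each y comes from two integers x, and the identity is used at 2n,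
-- which doubles the weight n on one side and gives `W` = 2 `G-triangular` on the other.
triangular-logDerivative : ∀ B → LogDerivative B triangle (rangeℕ B) G-triangular
triangular-logDerivative B n n≤B = sym (ℤ.*-cancelˡ-≡ (+ 4) _ _ (begin
  + 4 * ∑ (rangeℕ B) (λ y → G-triangular (n ∸ triangle y))
    ≡⟨ four (rangeℕ B) (λ y → G-triangular (n ∸ triangle y)) ⟩
  + 2 * ∑ (rangeℕ B) (λ y → + 2 * G-triangular (n ∸ triangle y))
    ≡⟨ cong (+ 2 *_) (∑-cong (rangeℕ B) W-value) ⟨
  + 2 * ∑ (rangeℕ B) (λ y → W (+ (y ℕ.* suc y)))
    ≡⟨ ∑-pronic W (ℕ.m≤m+n B _) (λ y B<y → trans (W-value y)
         (cong (λ j → + 2 * G-triangular j) (ℕ.m≤n⇒m∸n≡0 (ℕ.<⇒≤ (n<triangle y B<y))))) ⟨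
  ∑ (symmetric (suc R)) (λ x → W (x * (x + + 1)))
    ≡⟨ Form.divisor-identity 1 ℕ.≤-refl N {suc R} {D} (s≤s (ℕ.m≤n+m _ B)) ℕ.≤-refl ⟩
  ∑ (symmetric (suc R)) (λ x → δ (x * (x + + 1) - + N) * + N)
    ≡⟨ ∑-pronic (λ q → δ (q - + N) * + N) (ℕ.m≤m+n B _) (λ y B<y → trans (L-value y)
         (cong (λ d → + 2 * (d * + n)) (δ-≢ (ℕ.>⇒≢ (n<triangle y B<y))))) ⟩
  + 2 * ∑ (rangeℕ B) (λ y → δ (+ (y ℕ.* suc y) - + N) * + N)
    ≡⟨ cong (+ 2 *_) (∑-cong (rangeℕ B) L-value) ⟩
  + 2 * ∑ (rangeℕ B) (λ y → + 2 * (δ (+ triangle y - + n) * + n))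
    ≡⟨ four (rangeℕ B) (λ y → δ (+ triangle y - + n) * + n) ⟨
  + 4 * ∑ (rangeℕ B) (λ y → δ (+ triangle y - + n) * + n) ∎))
  where
  -- The form x (x + 1) takes twice the triangular numbers as values, so C is 2n.
  N = n ℕ.* 2
  R = B ℕ.+ (N ℕ.+ N)
  D = N ℕ.+ (suc R ℕ.+ suc R ℕ.+ 1 ℕ.+ N)
  n≤D : n ≤ D
  n≤D = ℕ.≤-trans (ℕ.m≤m*n n 2) (ℕ.m≤m+n N _)
  T : ℕ → ℤ → ℤ
  T c q = τ D c (+_) (+ N - q)
  W : ℤ → ℤ
  W q = sgn (+ 1) * (+ 8 * T 4 q - + 6 * T 2 q + T 1 q) - (+ 2 * T 2 q - T 1 q) - + 2 * T 2 q
  n<triangle : ∀ y → B < y → n < triangle y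
  n<triangle y B<y = ℕ.≤-<-trans n≤B (ℕ.<-≤-trans B<y (y≤triangle y))
  four : ∀ (xs : List ℕ) f → + 4 * ∑ xs f ≡ + 2 * ∑ xs (λ y → + 2 * f y)
  four xs f = trans (2*2 (∑ xs f)) (cong (+ 2 *_) (sym (∑-* (+ 2) xs f)))
    where
    2*2 : ∀ x → + 4 * x ≡ + 2 * (+ 2 * x)
    2*2 = solve-∀
  T-value : ∀ c .{{_ : NonZero c}} y → T (2 ℕ.* c) (+ (y ℕ.* suc y)) ≡ σ⁺ c (n ∸ triangle y)
  T-value c y = trans (cong (λ q → T (2 ℕ.* c) (+ q)) (sym (triangle-double y)))
    (trans (τ-double D c (+_) n (triangle y)) (τ-σ⁺ c n (triangle y) n≤D))
  combine : ∀ a b c → - + 1 * (+ 8 * c - + 6 * b + a) - (+ 2 * b - a) - + 2 * b ≡ + 2 * (b - + 4 * c)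
  combine = solve-∀
  W-value : ∀ y → W (+ (y ℕ.* suc y)) ≡ + 2 * G-triangular (n ∸ triangle y)
  W-value y = trans (combine (T 1 q) (T 2 q) (T 4 q))
    (cong₂ (λ a b → + 2 * (a - + 4 * b)) (T-value 1 y) (T-value 2 y))
    where
    q : ℤ
    q = + (y ℕ.* suc y)
  twice : ∀ d n → d * (n * + 2) ≡ + 2 * (d * n)
  twice = solve-∀
  L-value : ∀ y → δ (+ (y ℕ.* suc y) - + N) * + N ≡ + 2 * (δ (+ triangle y - + n) * + n)
  L-value y = begin
    δ (+ (y ℕ.* suc y) - + N) * + N
      ≡⟨ cong (λ q → δ (+ q - + N) * + N) (triangle-double y) ⟨
    δ (+ (triangle y ℕ.* 2) - + N) * + N
      ≡⟨ cong₂ _*_ (δ-cong-⇔ (ℕ.*-cancelʳ-≡ (triangle y) n 2) (cong (ℕ._* 2))) (ℤ.pos-* n 2) ⟩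
    δ (+ triangle y - + n) * (+ n * + 2)
      ≡⟨ twice (δ (+ triangle y - + n)) (+ n) ⟩
    + 2 * (δ (+ triangle y - + n) * + n) ∎

-- Products

-- The Leibniz rule for monomials: on the support n = a + b the two degrees are `n ∸ a` = b and
-- `n ∸ b` = a.
δ-product : ∀ a b n → δ (+ (a ℕ.+ b) - + n) * + n ≡
  δ (+ b - + (n ∸ a)) * + (n ∸ a) + δ (+ a - + (n ∸ b)) * + (n ∸ b)
δ-product a b n with a ℕ.+ b ℕ.≟ n
... | yes refl = begin
  δ (+ (a ℕ.+ b) - + (a ℕ.+ b)) * + (a ℕ.+ b)
    ≡⟨ trans (cong (_* + (a ℕ.+ b)) (δ-≡ {a ℕ.+ b} refl)) (ℤ.*-identityˡ _) ⟩
  + (a ℕ.+ b)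
    ≡⟨ cong +_ (ℕ.+-comm a b) ⟩
  + b + + a
    ≡⟨ cong₂ _+_ (diagonal (ℕ.m+n∸m≡n a b)) (diagonal (ℕ.m+n∸n≡m a b)) ⟨
  δ (+ b - + (a ℕ.+ b ∸ a)) * + (a ℕ.+ b ∸ a) + δ (+ a - + (a ℕ.+ b ∸ b)) * + (a ℕ.+ b ∸ b) ∎
  where
  diagonal : ∀ {b c} → c ≡ b → δ (+ b - + c) * + c ≡ + b
  diagonal {b} refl = trans (cong (_* + b) (δ-≡ {b} refl)) (ℤ.*-identityˡ (+ b))
... | no a+b≢n = trans (cong (_* + n) (δ-≢ a+b≢n))
  (sym (cong₂ _+_ (vanish a b a+b≢n) (vanish b a (a+b≢n ∘ trans (ℕ.+-comm a b)))))
  where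
  vanish : ∀ a b → a ℕ.+ b ≢ n → δ (+ b - + (n ∸ a)) * + (n ∸ a) ≡ + 0
  vanish a b a+b≢n with a ℕ.≤? n
  ... | yes a≤n = cong (_* + (n ∸ a)) (δ-≢ (λ eq → a+b≢n (trans (cong (a ℕ.+_) eq) (ℕ.m+[n∸m]≡n a≤n))))
  -- Truncation makes `n ∸ a` equal to 0, so the indicator can be 1 when b = 0; the factor `n ∸ a`
  -- still kills the term.
  ... | no  a≰n = trans (cong (λ z → δ (+ b - + z) * + z) (ℕ.m≤n⇒m∸n≡0 (ℕ.<⇒≤ (ℕ.≰⇒> a≰n))))
                        (ℤ.*-zeroʳ (δ (+ b - + 0)))

-- After the Leibniz rule, each hypothesis is applied at a lower degree, `n ∸ s x` or `n ∸ t y`;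
-- hence `LogDerivative` covers all degrees up to a bound. Iterated truncated subtraction still
-- subtracts the sum.
logDerivative-product : ∀ {N} (s : A → ℕ) (t : B → ℕ) xs ys G H →
  LogDerivative N s xs G → LogDerivative N t ys H → ∀ n → n ≤ N →
  ∑ xs (λ x → ∑ ys (λ y → δ (+ (s x ℕ.+ t y) - + n) * + n)) ≡
  ∑ xs (λ x → ∑ ys (λ y → G (n ∸ (s x ℕ.+ t y)) + H (n ∸ (s x ℕ.+ t y))))
logDerivative-product {A = A} {B = B} s t xs ys G H xs-G ys-H n n≤N = begin
  ∑ xs (λ x → ∑ ys (λ y → δ (+ (s x ℕ.+ t y) - + n) * + n))
    ≡⟨ ∑-cong xs (λ x → ∑-cong ys (λ y → δ-product (s x) (t y) n)) ⟩
  ∑ xs (λ x → ∑ ys (λ y → a x y + b x y))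
    ≡⟨ ∑∑-+ a b ⟩
  ∑ xs (λ x → ∑ ys (a x)) + ∑ xs (λ x → ∑ ys (b x))
    ≡⟨ ℤ.+-comm (∑ xs (λ x → ∑ ys (a x))) _ ⟩
  ∑ xs (λ x → ∑ ys (b x)) + ∑ xs (λ x → ∑ ys (a x))
    ≡⟨ cong₂ _+_ b-sum a-sum ⟩
  ∑ xs (λ x → ∑ ys (λ y → G (n ∸ (s x ℕ.+ t y)))) + ∑ xs (λ x → ∑ ys (λ y → H (n ∸ (s x ℕ.+ t y))))
    ≡⟨ ∑∑-+ (λ x y → G (n ∸ (s x ℕ.+ t y))) (λ x y → H (n ∸ (s x ℕ.+ t y))) ⟨
  ∑ xs (λ x → ∑ ys (λ y → G (n ∸ (s x ℕ.+ t y)) + H (n ∸ (s x ℕ.+ t y)))) ∎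
  where
  a b : A → B → ℤ
  a x y = δ (+ t y - + (n ∸ s x)) * + (n ∸ s x)
  b x y = δ (+ s x - + (n ∸ t y)) * + (n ∸ t y)
  ∑∑-+ : ∀ (f g : A → B → ℤ) → ∑ xs (λ x → ∑ ys (λ y → f x y + g x y)) ≡ ∑ xs (λ x → ∑ ys (f x)) + ∑ xs (λ x → ∑ ys (g x))
  ∑∑-+ f g = trans (∑-cong xs (λ x → ∑-+ ys (f x) (g x))) (∑-+ xs _ _)
  a-sum : ∑ xs (λ x → ∑ ys (a x)) ≡ ∑ xs (λ x → ∑ ys (λ y → H (n ∸ (s x ℕ.+ t y))))
  a-sum = ∑-cong xs (λ x → trans (ys-H (n ∸ s x) (ℕ.≤-trans (ℕ.m∸n≤m n (s x)) n≤N))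
    (∑-cong ys (λ y → cong H (ℕ.∸-+-assoc n (s x) (t y)))))
  b-sum : ∑ xs (λ x → ∑ ys (b x)) ≡ ∑ xs (λ x → ∑ ys (λ y → G (n ∸ (s x ℕ.+ t y))))
  b-sum = begin
    ∑ xs (λ x → ∑ ys (b x))
      ≡⟨ ∑-swap xs ys b ⟩
    ∑ ys (λ y → ∑ xs (λ x → b x y))
      ≡⟨ ∑-cong ys (λ y → trans (xs-G (n ∸ t y) (ℕ.≤-trans (ℕ.m∸n≤m n (t y)) n≤N))
           (∑-cong xs (λ x → cong G (trans (ℕ.∸-+-assoc n (t y) (s x)) (cong (n ∸_) (ℕ.+-comm (t y) (s x))))))) ⟩
    ∑ ys (λ y → ∑ xs (λ x → G (n ∸ (s x ℕ.+ t y))))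
      ≡⟨ ∑-swap xs ys (λ x y → G (n ∸ (s x ℕ.+ t y))) ⟨
    ∑ xs (λ x → ∑ ys (λ y → G (n ∸ (s x ℕ.+ t y)))) ∎

-- The generating functions of xs and ys agree up to degree j.
Agree : ℕ → (A → ℕ) → List A → List A → Set
Agree j s xs ys = ∀ (g : ℕ → ℤ) → (∀ i → j < i → g i ≡ + 0) → ∑ xs (g ∘ s) ≡ ∑ ys (g ∘ s)

-- One factor is exchanged at a time: for fixed x the test function `g (s x + i)` of i again
-- vanishes for i > j.
agree-product : ∀ {j} (s : A → ℕ) (t : B → ℕ) xs xs′ ys ys′ →
  Agree j s xs xs′ → Agree j t ys ys′ → ∀ (g : ℕ → ℤ) → (∀ i → j < i → g i ≡ + 0) →
  ∑ xs (λ x → ∑ ys (λ y → g (s x ℕ.+ t y))) ≡ ∑ xs′ (λ x → ∑ ys′ (λ y → g (s x ℕ.+ t y)))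
agree-product s t xs xs′ ys ys′ xs≈xs′ ys≈ys′ g g≡0 = begin
  ∑ xs (λ x → ∑ ys (λ y → g (s x ℕ.+ t y)))
    ≡⟨ ∑-cong xs (λ x → ys≈ys′ (λ i → g (s x ℕ.+ i)) (λ i j<i → g≡0 _ (ℕ.<-≤-trans j<i (ℕ.m≤n+m i (s x))))) ⟩
  ∑ xs (λ x → ∑ ys′ (λ y → g (s x ℕ.+ t y)))
    ≡⟨ ∑-swap xs ys′ _ ⟩
  ∑ ys′ (λ y → ∑ xs (λ x → g (s x ℕ.+ t y)))
    ≡⟨ ∑-cong ys′ (λ y → xs≈xs′ (λ i → g (i ℕ.+ t y)) (λ i j<i → g≡0 _ (ℕ.<-≤-trans j<i (ℕ.m≤m+n i (t y))))) ⟩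
  ∑ ys′ (λ y → ∑ xs′ (λ x → g (s x ℕ.+ t y)))
    ≡⟨ ∑-swap xs′ ys′ _ ⟨
  ∑ xs′ (λ x → ∑ ys′ (λ y → g (s x ℕ.+ t y))) ∎

-- Powers of a generating function as sums over vectors.

∑-vecsFrom : ∀ k (xs : List A) f →
  ∑ (vecsFrom (suc k) xs) f ≡ ∑ xs (λ x → ∑ (vecsFrom k xs) (λ v → f (x ∷ v)))
∑-vecsFrom k xs f = trans (∑-concatMap _ xs f) (∑-cong xs (λ x → ∑-map (x ∷_) (vecsFrom k xs) f))

-- The function `sum` is abstract, subject to its two recursion equations, so that `sumSq` and
-- `sumTri` share one treatment.
module Power (s : A → ℕ) (sum : ∀ {k} → Vec A k → ℕ)
  (sum-[] : sum [] ≡ 0) (sum-∷ : ∀ {k} x (v : Vec A k) → sum (x ∷ v) ≡ s x ℕ.+ sum v) where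

  logDerivative-power : ∀ {N} xs G → LogDerivative N s xs G → ∀ k →
    LogDerivative N (sum {k}) (vecsFrom k xs) (λ j → + k * G j)
  logDerivative-power xs G xs-G zero n n≤N =
    -- The empty vector stands for the constant series 1: the indicator requires n = 0, and then the
    -- factor n vanishes.
    cong (_+ + 0) (trans (cong (λ z → δ (+ z - + n) * + n) sum-[])
      (δ-*-zero (+ 0 - + n) (λ eq → sym (ℤ.i-j≡0⇒i≡j (+ 0) (+ n) eq))))
  logDerivative-power xs G xs-G (suc k) n n≤N = begin
    ∑ (vecsFrom (suc k) xs) (λ v → δ (+ sum v - + n) * + n)
      ≡⟨ trans (∑-vecsFrom k xs _) (∑-cong xs (λ x → ∑-cong (vecsFrom k xs)
           (λ v → cong (λ z → δ (+ z - + n) * + n) (sum-∷ x v)))) ⟩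
    ∑ xs (λ x → ∑ (vecsFrom k xs) (λ v → δ (+ (s x ℕ.+ sum v) - + n) * + n))
      ≡⟨ logDerivative-product s sum xs (vecsFrom k xs) G (λ j → + k * G j) xs-G (logDerivative-power xs G xs-G k) n n≤N ⟩
    ∑ xs (λ x → ∑ (vecsFrom k xs) (λ v → G (n ∸ (s x ℕ.+ sum v)) + + k * G (n ∸ (s x ℕ.+ sum v))))
      ≡⟨ trans (∑-vecsFrom k xs _) (∑-cong xs (λ x → ∑-cong (vecsFrom k xs)
           (λ v → trans (cong (λ z → + suc k * G (n ∸ z)) (sum-∷ x v)) (ℤ.suc-* (+ k) _)))) ⟨
    ∑ (vecsFrom (suc k) xs) (λ v → + suc k * G (n ∸ sum v)) ∎

  agree-power : ∀ {j} xs ys → Agree j s xs ys → ∀ k → Agree j (sum {k}) (vecsFrom k xs) (vecsFrom k ys)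
  agree-power xs ys xs≈ys zero g g≡0 = refl
  agree-power xs ys xs≈ys (suc k) g g≡0 = begin
    ∑ (vecsFrom (suc k) xs) (g ∘ sum)
      ≡⟨ expand xs ⟩
    ∑ xs (λ x → ∑ (vecsFrom k xs) (λ v → g (s x ℕ.+ sum v)))
      ≡⟨ agree-product s sum xs ys (vecsFrom k xs) (vecsFrom k ys) xs≈ys (agree-power xs ys xs≈ys k) g g≡0 ⟩
    ∑ ys (λ x → ∑ (vecsFrom k ys) (λ v → g (s x ℕ.+ sum v)))
      ≡⟨ expand ys ⟨
    ∑ (vecsFrom (suc k) ys) (g ∘ sum) ∎
    where
    expand : ∀ xs → ∑ (vecsFrom (suc k) xs) (g ∘ sum) ≡ ∑ xs (λ x → ∑ (vecsFrom k xs) (λ v → g (s x ℕ.+ sum v)))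
    expand xs = trans (∑-vecsFrom k xs _) (∑-cong xs (λ x → ∑-cong (vecsFrom k xs) (λ v → cong g (sum-∷ x v))))

  ∑-power-singleton : ∀ {x} → s x ≡ 0 → ∀ k (g : ℕ → ℤ) → ∑ (vecsFrom k (x ∷ [])) (g ∘ sum) ≡ g 0
  ∑-power-singleton sx≡0 zero g = trans (ℤ.+-identityʳ _) (cong g sum-[])
  ∑-power-singleton {x} sx≡0 (suc k) g = begin
    ∑ (vecsFrom (suc k) (x ∷ [])) (g ∘ sum)
      ≡⟨ trans (∑-vecsFrom k (x ∷ []) (g ∘ sum)) (ℤ.+-identityʳ _) ⟩
    ∑ (vecsFrom k (x ∷ [])) (λ v → g (sum (x ∷ v)))
      ≡⟨ ∑-cong (vecsFrom k (x ∷ [])) (λ v → cong g (trans (sum-∷ x v) (cong (ℕ._+ sum v) sx≡0))) ⟩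
    ∑ (vecsFrom k (x ∷ [])) (g ∘ sum)
      ≡⟨ ∑-power-singleton sx≡0 k g ⟩
    g 0 ∎

module Squares   = Power (λ x → ∣ x * x ∣) sumSq refl (λ _ _ → refl)
module Triangles = Power triangle sumTri refl (λ _ _ → refl)

agree-rangeℤ : ∀ {j n} → j ≤ n → Agree j (λ x → ∣ x * x ∣) (rangeℤ n) (rangeℤ j)
agree-rangeℤ {j} {n} j≤n g g≡0 = trans (∑-rangeℤ n _) (trans
  (∑-symmetric-extend (λ x → g ∣ x * x ∣) (λ x j<x → g≡0 _ (ℕ.<-≤-trans j<x (∣x∣≤∣x*x∣ x))) j≤n)
  (sym (∑-rangeℤ j _)))

agree-rangeℕ : ∀ {j n} → j ≤ n → Agree j triangle (rangeℕ n) (rangeℕ j)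
agree-rangeℕ {j} {n} j≤n g g≡0 = trans (∑-rangeℕ n (g ∘ triangle)) (trans
  (cong (_+_ (g 0)) (∑-interval-extend (g ∘ triangle) (λ y j<y → g≡0 _ (ℕ.<-≤-trans j<y (y≤triangle y))) j≤n))
  (sym (∑-rangeℕ j (g ∘ triangle))))

length-filter : ∀ {P : A → Set} (P? : Decidable P) {f} →
  (∀ {x} → P x → f x ≡ + 1) → (∀ {x} → ¬ P x → f x ≡ + 0) → ∀ xs → + length (filter P? xs) ≡ ∑ xs f
length-filter P? f≡1 f≡0 []       = refl
length-filter P? {f} f≡1 f≡0 (x ∷ xs) with P? x
... | yes px = cong₂ _+_ (sym (f≡1 px)) (length-filter P? f≡1 f≡0 xs)
... | no ¬px = trans (length-filter P? f≡1 f≡0 xs)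
                     (trans (sym (ℤ.+-identityˡ _)) (cong (_+ ∑ xs f) (sym (f≡0 ¬px))))

-- Comparison of coefficients and the recurrence for `u`.

module Recurrence (k l : ℕ) where

  ∑box : ℕ → (ℕ → ℤ) → ℤ
  ∑box n g = ∑ (vecsFrom k (rangeℤ n)) λ xs → ∑ (vecsFrom l (rangeℕ n)) λ ys → g (sumSq xs ℕ.+ sumTri ys)

  u-∑box : ∀ n → + u k l n ≡ ∑box n (λ q → δ (+ q - + n))
  u-∑box n = begin
    + u k l n
      ≡⟨ length-filter (λ p → sumSq (proj₁ p) ℕ.+ sumTri (proj₂ p) ℕ.≟ n) δ-≡ δ-≢
           (concatMap (λ xs → map (xs ,_) (vecsFrom l (rangeℕ n))) (vecsFrom k (rangeℤ n))) ⟩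
    ∑ (concatMap (λ xs → map (xs ,_) (vecsFrom l (rangeℕ n))) (vecsFrom k (rangeℤ n))) f
      ≡⟨ ∑-concatMap (λ xs → map (xs ,_) (vecsFrom l (rangeℕ n))) (vecsFrom k (rangeℤ n)) f ⟩
    ∑ (vecsFrom k (rangeℤ n)) (λ xs → ∑ (map (xs ,_) (vecsFrom l (rangeℕ n))) f)
      ≡⟨ ∑-cong (vecsFrom k (rangeℤ n)) (λ xs → ∑-map (xs ,_) (vecsFrom l (rangeℕ n)) f) ⟩
    ∑box n (λ q → δ (+ q - + n)) ∎
    where
    f : Vec ℤ k × Vec ℕ l → ℤ
    f p = δ (+ (sumSq (proj₁ p) ℕ.+ sumTri (proj₂ p)) - + n)

  -- Each `u k l j` is counted in a box depending on j, whereas the recurrence compares all j ≤ n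
  -- inside one box. The additional tuples have an entry of absolute value above j, hence a value
  -- above j.
  u-∑box-≤ : ∀ {j n} → j ≤ n → + u k l j ≡ ∑box n (λ q → δ (+ q - + j))
  u-∑box-≤ {j} {n} j≤n = trans (u-∑box j) (sym (agree-product sumSq sumTri
    (vecsFrom k (rangeℤ n)) (vecsFrom k (rangeℤ j)) (vecsFrom l (rangeℕ n)) (vecsFrom l (rangeℕ j))
    (Squares.agree-power (rangeℤ n) (rangeℤ j) (agree-rangeℤ j≤n) k)
    (Triangles.agree-power (rangeℕ n) (rangeℕ j) (agree-rangeℕ j≤n) l)
    (λ q → δ (+ q - + j)) (λ q j<q → δ-≢ (ℕ.>⇒≢ j<q))))

  u-zero : + u k l 0 ≡ + 1
  u-zero = begin
    + u k l 0
      ≡⟨ u-∑box 0 ⟩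
    ∑ (vecsFrom k (rangeℤ 0)) (λ xs → ∑ (vecsFrom l (rangeℕ 0)) (λ ys → δ (+ (sumSq xs ℕ.+ sumTri ys) - + 0)))
      ≡⟨ ∑-cong (vecsFrom k (rangeℤ 0)) (λ xs →
           Triangles.∑-power-singleton refl l (λ t → δ (+ (sumSq xs ℕ.+ t) - + 0))) ⟩
    ∑ (vecsFrom k (rangeℤ 0)) (λ xs → δ (+ (sumSq xs ℕ.+ 0) - + 0))
      ≡⟨ Squares.∑-power-singleton refl k (λ q → δ (+ (q ℕ.+ 0) - + 0)) ⟩
    + 1 ∎

  G : ℕ → ℤ
  G j = + k * G-square j + + l * G-triangular j

  G-zero : G 0 ≡ + 0
  G-zero = cong₂ _+_ (ℤ.*-zeroʳ (+ k)) (ℤ.*-zeroʳ (+ l))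

  -- This sorts by the value q of the form. The value 0 is kept apart because it yields the term
  -- with u(0) = 1, and values above n contribute `G 0` = 0.
  by-value : ∀ n q → G (suc n ∸ q) ≡
    δ (+ q - + 0) * G (suc n) + ∑ (interval n) (λ j → δ (+ q - + j) * G (suc n ∸ j))
  by-value n zero = sym (begin
    + 1 * G (suc n) + ∑ (interval n) (λ j → δ (+ 0 - + j) * G (suc n ∸ j))
      ≡⟨ cong₂ _+_ (ℤ.*-identityˡ (G (suc n))) (trans (∑-interval-cong n (λ j 1≤j _ →
           cong (_* G (suc n ∸ j)) (δ-≢ (ℕ.<⇒≢ 1≤j)))) (∑-zero (interval n) (λ _ → refl))) ⟩
    G (suc n) + + 0
      ≡⟨ ℤ.+-identityʳ _ ⟩
    G (suc n) ∎)
  by-value n q@(suc q-1) = trans (only (q ℕ.≤? n)) (sym (ℤ.+-identityˡ _))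
    where
    only : Dec (q ≤ n) → G (suc n ∸ q) ≡ ∑ (interval n) (λ j → δ (+ q - + j) * G (suc n ∸ j))
    only (yes q≤n) = sym (trans
      (∑-interval-single n (λ j → δ (+ q - + j) * G (suc n ∸ j)) q (s≤s z≤n) q≤n
        (λ j j≢q → cong (_* G (suc n ∸ j)) (δ-≢ (j≢q ∘ sym))))
      (trans (cong (_* G (suc n ∸ q)) (δ-≡ {q} refl)) (ℤ.*-identityˡ _)))
    only (no q≰n) = trans (trans (cong G (ℕ.m≤n⇒m∸n≡0 (ℕ.≰⇒> q≰n))) G-zero)
      (sym (trans (∑-interval-cong n (λ j _ j≤n → cong (_* G (suc n ∸ j))
             (δ-≢ (λ q≡j → q≰n (subst (_≤ n) (sym q≡j) j≤n)))))
           (∑-zero (interval n) (λ _ → refl))))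

  ∑box-cong : ∀ n {f g} → (∀ q → f q ≡ g q) → ∑box n f ≡ ∑box n g
  ∑box-cong n eq = ∑-cong (vecsFrom k (rangeℤ n)) (λ xs → ∑-cong (vecsFrom l (rangeℕ n)) (λ ys → eq _))

  ∑box-+ : ∀ n f g → ∑box n (λ q → f q + g q) ≡ ∑box n f + ∑box n g
  ∑box-+ n f g = trans (∑-cong (vecsFrom k (rangeℤ n)) (λ xs → ∑-+ (vecsFrom l (rangeℕ n)) _ _))
                       (∑-+ (vecsFrom k (rangeℤ n)) _ _)

  ∑box-* : ∀ n c f → ∑box n (λ q → f q * c) ≡ ∑box n f * c
  ∑box-* n c f = begin
    ∑box n (λ q → f q * c)  ≡⟨ ∑box-cong n (λ q → ℤ.*-comm (f q) c) ⟩
    ∑box n (λ q → c * f q)  ≡⟨ trans (∑-cong (vecsFrom k (rangeℤ n)) (λ xs → ∑-* c (vecsFrom l (rangeℕ n)) _))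
                                     (∑-* c (vecsFrom k (rangeℤ n)) _) ⟩
    c * ∑box n f            ≡⟨ ℤ.*-comm c _ ⟩
    ∑box n f * c            ∎

  ∑box-∑ : ∀ n js (f : ℕ → ℕ → ℤ) → ∑box n (λ q → ∑ js (λ j → f q j)) ≡ ∑ js (λ j → ∑box n (λ q → f q j))
  ∑box-∑ n js f = trans (∑-cong (vecsFrom k (rangeℤ n)) (λ xs → ∑-swap (vecsFrom l (rangeℕ n)) js _))
                        (∑-swap (vecsFrom k (rangeℤ n)) js _)

  recurrence : ∀ n → + suc n * + u k l (suc n) ≡
    G (suc n) + ∑ (interval n) (λ j → + u k l j * G (suc n ∸ j))
  recurrence n = begin
    + N * + u k l N
      ≡⟨ trans (ℤ.*-comm (+ N) _) (cong (_* + N) (u-∑box N)) ⟩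
    ∑box N (λ q → δ (+ q - + N)) * + N
      ≡⟨ ∑box-* N (+ N) (λ q → δ (+ q - + N)) ⟨
    ∑box N (λ q → δ (+ q - + N) * + N)
      ≡⟨ logDerivative-product sumSq sumTri (vecsFrom k (rangeℤ N)) (vecsFrom l (rangeℕ N))
           (λ j → + k * G-square j) (λ j → + l * G-triangular j)
           (Squares.logDerivative-power (rangeℤ N) G-square (square-logDerivative N) k)
           (Triangles.logDerivative-power (rangeℕ N) G-triangular (triangular-logDerivative N) l) N ℕ.≤-refl ⟩
    ∑box N (λ q → G (N ∸ q))
      ≡⟨ trans (∑box-cong N (by-value n)) (∑box-+ N (λ q → δ (+ q - + 0) * G N) (λ q → ∑ (interval n) (λ j → δ (+ q - + j) * G (N ∸ j)))) ⟩
    ∑box N (λ q → δ (+ q - + 0) * G N) + ∑box N (λ q → ∑ (interval n) (λ j → δ (+ q - + j) * G (N ∸ j)))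
      ≡⟨ cong₂ _+_ (coefficient 0 z≤n) (trans (∑box-∑ N (interval n) (λ q j → δ (+ q - + j) * G (N ∸ j)))
           (∑-interval-cong n (λ j _ j≤n → coefficient j (ℕ.m≤n⇒m≤1+n j≤n)))) ⟩
    + u k l 0 * G N + ∑ (interval n) (λ j → + u k l j * G (N ∸ j))
      ≡⟨ cong (_+ ∑ (interval n) (λ j → + u k l j * G (N ∸ j)))
           (trans (cong (_* G N) u-zero) (ℤ.*-identityˡ (G N))) ⟩
    G N + ∑ (interval n) (λ j → + u k l j * G (N ∸ j)) ∎
    where
    N = suc n
    coefficient : ∀ j → j ≤ N → ∑box N (λ q → δ (+ q - + j) * G (N ∸ j)) ≡ + u k l j * G (N ∸ j)
    coefficient j j≤N = trans (∑box-* N (G (N ∸ j)) (λ q → δ (+ q - + j)))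
      (cong (_* G (N ∸ j)) (sym (u-∑box-≤ j≤N)))

  G-value : ∀ j → 1 ≤ j → G j ≡
    + (2 ℕ.* k ℕ.+ l) * + σ (+ j / 1) - + 2 * + (5 ℕ.* k ℕ.+ 2 ℕ.* l) * + σ (+ j / 2) + + 8 * + k * + σ (+ j / 4)
  G-value j@(suc _) _ = trans (collect (+ k) (+ l) (+ σ (+ j / 1)) (+ σ (+ j / 2)) (+ σ (+ j / 4)))
    (cong₂ (λ x y → x * + σ (+ j / 1) - + 2 * y * + σ (+ j / 2) + + 8 * + k * + σ (+ j / 4))
      (cong (_+ + l) (sym (ℤ.pos-* 2 k)))
      (cong₂ _+_ (sym (ℤ.pos-* 5 k)) (sym (ℤ.pos-* 2 l))))
    where
    collect : ∀ k l a b c → k * (+ 2 * a - + 10 * b + + 8 * c) + l * (a - + 4 * b) ≡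
      (+ 2 * k + l) * a - + 2 * (+ 5 * k + + 2 * l) * b + + 8 * k * c
    collect = solve-∀

sumℤ-map : ∀ (f : A → ℤ) xs → sumℤ (map f xs) ≡ ∑ xs f
sumℤ-map f []       = refl
sumℤ-map f (x ∷ xs) = cong (_+_ (f x)) (sumℤ-map f xs)

theorem2p6 : (k l n : ℕ) → k ≥ 1 → l ≥ 1 → n ≥ 1 →
    + n * + u k l n ≡
    (+ (2 Data.Nat.* k Data.Nat.+ l) * + σ (+ n / 1)
    - + 2 * + (5 Data.Nat.* k Data.Nat.+ 2 Data.Nat.* l) * + σ (+ n / 2)
    + + 8 * + k * + σ (+ n / 4))
    + sumℤ (map (λ j → + u k l j *
    (+ (2 Data.Nat.* k Data.Nat.+ l) * + σ (+ (n ∸ j) / 1)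
    - + 2 * + (5 Data.Nat.* k Data.Nat.+ 2 Data.Nat.* l) * + σ (+ (n ∸ j) / 2)
    + + 8 * + k * + σ (+ (n ∸ j) / 4)))
    (applyUpTo suc (n ∸ 1)))
theorem2p6 k l (suc n) _ _ _ = trans (recurrence n) (cong₂ _+_ (G-value (suc n) (s≤s z≤n))
  -- For j ≤ n the difference `suc n ∸ j` is at least 1, where `σ⁺` and σ agree.
  (trans (∑-interval-cong n (λ j _ j≤n → cong (+ u k l j *_) (G-value (suc n ∸ j) (ℕ.m<n⇒0<n∸m (s≤s j≤n)))))
    (trans (sym (∑-applyUpTo-suc n _)) (sym (sumℤ-map _ (applyUpTo suc n))))))
  where open Recurrence k l
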